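{- Let $X$ be a finite set with $|X|\geqslant 2$. Then: (1) if $|X|$ is prime, the commuting graph $\mathcal{G}(\mathcal{P}(X))$ is not connected; (2) if $|X|=4$, then $\mathrm{diam}\,\mathcal{G}(\mathcal{P}(X))=4$; (3) if $|X|\geqslant 6$ is composite, then $\mathrm{diam}\,\mathcal{G}(\mathcal{P}(X))=5$.
   Context: $\mathcal{P}(X)$ is the partial transformation semigroup on $X$: all functions whose domain and image are subsets of $X$ (including the empty map $\emptyset$), with composition as multiplication (maps act on the right). Its center is $\{\emptyset,\mathrm{id}_X\}$, and it is non-commutative when $|X|\geqslant 2$. For a finite non-commutative semigroup $S$, the commuting graph $\mathcal{G}(S)$ is the simple graph with vertex set $S\setminus Z(S)$ ($Z(S)$ the center), two distinct vertices $x,y$ being adjacent iff $xy=yx$. The distance between two vertices is the length of a shortest path between them ($\infty$ if none), and the diameter $\mathrm{diam}$ is the maximum distance over all pairs of vertices. -}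

module Defs where

open import Data.Nat using (ℕ; zero; suc; _≤_; _<_)
open import Data.Fin using (Fin)
open import Data.Maybe using (Maybe; just; nothing)
open import Data.Vec using (Vec; lookup; tabulate; replicate)
import Data.Vec as Vec
open import Data.Product using (Σ; ∃; _×_; proj₁)
open import Relation.Nullary using (¬_)
open import Relation.Binary.PropositionalEquality using (_≡_; _≢_)

-- Partial transformations of X = Fin n, represented by their graph:
-- the i-th entry is (i)f, or nothing if i ∉ dom f.  Equality of
-- partial maps is then propositional equality of vectors.
PT : ℕ → Set
PT n = Vec (Maybe (Fin n)) n

-- maps act on the right: (x)(f · g) = ((x)f)g
app : ∀ {n} → Maybe (Fin n) → PT n → Maybe (Fin n)
app nothing  g = nothing
app (just x) g = lookup g x

_·_ : ∀ {n} → PT n → PT n → PT n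
f · g = Vec.map (λ m → app m g) f

emptyMap : ∀ {n} → PT n
emptyMap = replicate _ nothing

idMap : ∀ {n} → PT n
idMap = tabulate just

Central : ∀ {n} → PT n → Set
Central {n} f = ∀ (g : PT n) → f · g ≡ g · f

Vertex : ℕ → Set
Vertex n = Σ (PT n) (λ f → ¬ Central f)

Adj : ∀ {n} → Vertex n → Vertex n → Set
Adj u v = proj₁ u ≢ proj₁ v × (proj₁ u · proj₁ v ≡ proj₁ v · proj₁ u)

data Walk {n : ℕ} : Vertex n → Vertex n → ℕ → Set where
  here : ∀ {u} → Walk u u 0
  step : ∀ {u v w k} → Adj u v → Walk v w k → Walk u w (suc k)

DistLe : ∀ {n} → Vertex n → Vertex n → ℕ → Set
DistLe u v k = ∃ λ m → m ≤ k × Walk u v m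

DistEq : ∀ {n} → Vertex n → Vertex n → ℕ → Set
DistEq u v d = Walk u v d × (∀ m → m < d → ¬ Walk u v m)

Connected : ℕ → Set
Connected n = ∀ (u v : Vertex n) → ∃ λ k → Walk u v k

Diam : ℕ → ℕ → Set
Diam n d = (∀ (u v : Vertex n) → DistLe u v d) × Σ (Vertex n) (λ u → Σ (Vertex n) (λ v → DistEq u v d))

{-# OPTIONS --safe #-}
-- Upper bound 5: id_A commutes with f whenever A is a union of components of the
-- functional graph of f, and any two id_A commute.  For composite n every vertex is at
-- distance at most 2 from some id_A with ∅ ≠ A ≠ X, unless it commutes with a constant
-- map; in the latter case one passes through a map that merges two points and fixes
-- the constant.
--
-- Lower bound: if some point generates X under h, then the centralizer of h consists
-- of ∅ and the powers of h, so whatever commutes with a neighbour of h commutes with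
-- the idempotent power e of h.  A path running into a k-cycle is such an h, and for
-- n ≥ 7 two of them can be placed so that only central maps commute with both
-- idempotents e and e′.  For n = 6 one of them is replaced by a 6-cycle.
--
-- For n = 4, every vertex commutes with one of 59 maps, any two of which have a common
-- neighbour; a 4-cycle is at distance 4 from a path running into a fixed point.
--
-- For prime n the nontrivial powers of an n-cycle form a component of the graph.
module Submission where

open import Defs
open import Data.Bool using (Bool; true; false; if_then_else_)
import Data.Bool.Properties as Bool
open import Data.Empty using (⊥; ⊥-elim)
open import Data.Fin using (Fin; zero; suc; toℕ; fromℕ; fromℕ<; inject₁; inject≤; punchOut; splitAt; _↑ˡ_; _↑ʳ_; _≟_)
open import Data.Fin.Induction using (<-weakInduction)
open import Data.Fin.Patterns using (0F; 1F; 2F; 3F; 4F; 5F)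
import Data.Fin.Properties as Fin
open import Data.Fin.Properties using (any?; all?; ¬∀⟶∃¬; injective⇒≤; pigeonhole; punchOut-injective; toℕ<n; toℕ-fromℕ<)
open import Data.List using (List; []; _∷_; _++_; filter; allFin; cartesianProductWith)
import Data.List as List
open import Data.List.Membership.Propositional using (_∈_; find)
open import Data.List.Relation.Unary.All using (All)
import Data.List.Relation.Unary.All as All
import Data.List.Relation.Unary.All.Properties as All
open import Data.List.Relation.Unary.Any using (Any)
import Data.List.Relation.Unary.Any as Any
open import Data.Maybe using (Maybe; just; nothing)
import Data.Maybe as Maybe
open import Data.Maybe.Properties using (just-injective; map-cong) renaming (≡-dec to Maybe-≟)
open import Data.Nat using (ℕ; zero; suc; pred; _+_; _*_; _∸_; _!; _≤_; _<_; z≤n; s≤s; s≤s⁻¹; z<s; s<s; nonTrivial⇒n>1)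
open import Data.Nat.Coprimality using (coprime-Bézout; prime⇒coprime)
open import Data.Nat.DivMod using (_%_; _/_; m≡m%n+[m/n]*n; m%n<n)
open import Data.Nat.Divisibility using (_∣_; divides; hasNonTrivialDivisor; ∣⇒≤; ∣-trans; m∣m*n; m≤n⇒m!∣n!)
open import Data.Nat.GCD using (module Bézout)
open import Data.Nat.Primality using (Prime; Composite)
import Data.Nat.Properties as ℕ
open import Data.Nat.Solver using (module +-*-Solver)
open import Data.Product using (∃; ∃₂; _×_; _,_; proj₁; proj₂)
open import Data.Sum using (_⊎_; inj₁; inj₂; [_,_]′)
open import Data.Vec using (Vec; []; _∷_; lookup; tabulate)
import Data.Vec.Properties as Vec
open import Function using (_∘_; mk⇔)
open import Relation.Binary.PropositionalEquality hiding ([_])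
open import Relation.Nullary using (¬_; Dec; yes; no; contradiction; does; ¬?)
open import Relation.Nullary.Decidable using (dec-true; dec-false; decidable-stable; does-⇔; map′; toWitness; _×-dec_; _⊎-dec_; _→-dec_)
open import Relation.Unary using (Decidable)

private
  variable
    n m : ℕ
    A   : Set

-- Iterates of a function.

infix 4 _~_
infixr 8 _^_

_^_ : (A → A) → ℕ → A → A
(h ^ zero)  x = x
(h ^ suc k) x = h ((h ^ k) x)

^-+ : ∀ (h : A → A) i j x → (h ^ (i + j)) x ≡ (h ^ i) ((h ^ j) x)
^-+ h zero    j x = refl
^-+ h (suc i) j x = cong h (^-+ h i j x)

^-* : ∀ (h : A → A) i j x → (h ^ (i * j)) x ≡ ((h ^ j) ^ i) x
^-* h zero    j x = refl
^-* h (suc i) j x = trans (^-+ h j (i * j) x) (cong (h ^ j) (^-* h i j x))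

^-comm : ∀ (h : A → A) i x → (h ^ i) (h x) ≡ h ((h ^ i) x)
^-comm h i x = trans (sym (^-+ h i 1 x)) (cong (λ j → (h ^ j) x) (ℕ.+-comm i 1))

^-swap : ∀ (h : A → A) i j x → (h ^ i) ((h ^ j) x) ≡ (h ^ j) ((h ^ i) x)
^-swap h i j x = trans (sym (^-+ h i j x)) (trans (cong (λ k → (h ^ k) x) (ℕ.+-comm i j)) (^-+ h j i x))

^-fixed : ∀ (h : A → A) i {x} → h x ≡ x → (h ^ i) x ≡ x
^-fixed h zero    e = refl
^-fixed h (suc i) e = trans (cong h (^-fixed h i e)) e

^-cong : ∀ {h h′ : A → A} → (∀ x → h x ≡ h′ x) → ∀ i x → (h ^ i) x ≡ (h′ ^ i) x
^-cong         h≗h′ zero    x = refl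
^-cong {h = h} h≗h′ (suc i) x = trans (cong h (^-cong h≗h′ i x)) (h≗h′ _)

^-injective : ∀ {h : A → A} → (∀ {x y} → h x ≡ h y → x ≡ y) →
              ∀ i {x y} → (h ^ i) x ≡ (h ^ i) y → x ≡ y
^-injective inj zero    e = e
^-injective inj (suc i) e = ^-injective inj i (inj e)

-- Commutation read pointwise.

_~_ : PT n → PT n → Set
f ~ g = f · g ≡ g · f

ext : {f g : PT n} → (∀ x → lookup f x ≡ lookup g x) → f ≡ g
ext {f = f} {g} eq =
  trans (sym (Vec.tabulate∘lookup f)) (trans (Vec.tabulate-cong eq) (Vec.tabulate∘lookup g))

lookup-· : ∀ (f g : PT n) x → lookup (f · g) x ≡ app (lookup f x) g
lookup-· f g x = Vec.lookup-map x _ f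

~-intro : ∀ {f g : PT n} → (∀ x → app (lookup f x) g ≡ app (lookup g x) f) → f ~ g
~-intro {f = f} {g} eq = ext λ x →
  trans (lookup-· f g x) (trans (eq x) (sym (lookup-· g f x)))

~-elim : ∀ {f g : PT n} → f ~ g → ∀ x → app (lookup f x) g ≡ app (lookup g x) f
~-elim {f = f} {g} fg x =
  trans (sym (lookup-· f g x)) (trans (cong (λ h → lookup h x) fg) (lookup-· g f x))

total : (Fin n → Fin n) → PT n
total h = tabulate (just ∘ h)

lookup-total : ∀ (h : Fin n → Fin n) x → lookup (total h) x ≡ just (h x)
lookup-total h = Vec.lookup∘tabulate (just ∘ h)

app-total : ∀ (h : Fin n → Fin n) m → app m (total h) ≡ Maybe.map h m
app-total h nothing  = refl
app-total h (just x) = lookup-total h x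

-- Commuting with a total map h, read as equivariance.
Equivariant : (Fin n → Fin n) → PT n → Set
Equivariant h f = ∀ x → lookup f (h x) ≡ Maybe.map h (lookup f x)

equivariant⇒~ : ∀ {h} {f : PT n} → Equivariant h f → f ~ total h
equivariant⇒~ {h = h} {f} eqv = ~-intro λ x →
  trans (app-total h (lookup f x)) (trans (sym (eqv x)) (sym (cong (λ m → app m f) (lookup-total h x))))

~⇒equivariant : ∀ {h} {f : PT n} → f ~ total h → Equivariant h f
~⇒equivariant {h = h} {f} fh x =
  trans (cong (λ m → app m f) (sym (lookup-total h x))) (trans (sym (~-elim fh x)) (app-total h (lookup f x)))

equivariant-^ : ∀ {h} {f : PT n} → Equivariant h f → ∀ i → Equivariant (h ^ i) f
equivariant-^ {f = f} eqv zero    x with lookup f x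
... | nothing = refl
... | just y  = refl
equivariant-^ {h = h} {f} eqv (suc i) x
  with lookup f x | equivariant-^ {h = h} {f} eqv i x
... | nothing | eq = trans (eqv _) (cong (Maybe.map h) eq)
... | just y  | eq = trans (eqv _) (cong (Maybe.map h) eq)

equivariant-cong : ∀ {h h′} {f : PT n} → (∀ x → h x ≡ h′ x) → Equivariant h f → Equivariant h′ f
equivariant-cong {f = f} h≗h′ eqv x =
  trans (cong (lookup f) (sym (h≗h′ x))) (trans (eqv x) (map-cong h≗h′ (lookup f x)))

total-~ : ∀ (g h : Fin n → Fin n) → (∀ x → g (h x) ≡ h (g x)) → total g ~ total h
total-~ g h gh = equivariant⇒~ λ x →
  trans (lookup-total g (h x)) (trans (cong just (gh x)) (cong (Maybe.map h) (sym (lookup-total g x))))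

total-~-elim : ∀ (g h : Fin n → Fin n) → total g ~ total h → ∀ x → g (h x) ≡ h (g x)
total-~-elim g h gh x = just-injective
  (trans (sym (lookup-total g (h x))) (trans (~⇒equivariant gh x) (cong (Maybe.map h) (lookup-total g x))))

-- Central and noncentral maps.

lookup-empty : ∀ (x : Fin n) → lookup (emptyMap {n}) x ≡ nothing
lookup-empty x = Vec.lookup-replicate x nothing

lookup-id : ∀ (x : Fin n) → lookup (idMap {n}) x ≡ just x
lookup-id = Vec.lookup∘tabulate just

emptyMap-central : Central (emptyMap {n})
emptyMap-central g = ~-intro {f = emptyMap} {g} λ x →
  trans (cong (λ m → app m g) (lookup-empty x)) (sym (app-empty (lookup g x)))
  where
  app-empty : ∀ m → app m emptyMap ≡ nothing
  app-empty nothing  = refl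
  app-empty (just x) = lookup-empty x

idMap-central : Central (idMap {n})
idMap-central g = ~-intro {f = idMap} {g} λ x →
  trans (cong (λ m → app m g) (lookup-id x)) (sym (app-id (lookup g x)))
  where
  app-id : ∀ m → app m idMap ≡ m
  app-id nothing  = refl
  app-id (just x) = lookup-id x

nowhere⇒central : ∀ {f : PT n} → (∀ x → lookup f x ≡ nothing) → Central f
nowhere⇒central eq = subst Central (ext λ x → trans (lookup-empty x) (sym (eq x))) emptyMap-central

identity⇒central : ∀ {f : PT n} → (∀ x → lookup f x ≡ just x) → Central f
identity⇒central eq = subst Central (ext λ x → trans (lookup-id x) (sym (eq x))) idMap-central

elementary : Fin n → Fin n → PT n
elementary a b = tabulate λ x → if does (x ≟ a) then just b else nothing

lookup-elementary : ∀ (a b x : Fin n) → lookup (elementary a b) x ≡ (if does (x ≟ a) then just b else nothing)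
lookup-elementary a b = Vec.lookup∘tabulate _

elementary-hit : ∀ (a b : Fin n) → lookup (elementary a b) a ≡ just b
elementary-hit a b = trans (lookup-elementary a b a)
  (cong (λ c → if c then just b else nothing) (dec-true (a ≟ a) refl))

elementary-miss : ∀ (a b : Fin n) {x} → x ≢ a → lookup (elementary a b) x ≡ nothing
elementary-miss a b {x} x≢a = trans (lookup-elementary a b x)
  (cong (λ c → if c then just b else nothing) (dec-false (x ≟ a) x≢a))

app-elementary-miss : ∀ (a b : Fin n) {m} → m ≢ just a → app m (elementary a b) ≡ nothing
app-elementary-miss a b {nothing} m≢a = refl
app-elementary-miss a b {just x}  m≢a = elementary-miss a b (m≢a ∘ cong just)

-- The partial identity `elementary x x` separates the two products at `x`: applied after `f` it is
-- undefined at `y`, applied before `f` it gives `y`.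
moves⇒noncentral : ∀ {f : PT n} {x y} → lookup f x ≡ just y → y ≢ x → ¬ Central f
moves⇒noncentral {f = f} {x} {y} fx y≢x central with
  trans (sym (trans (cong (λ m → app m (elementary x x)) fx) (elementary-miss x x y≢x)))
        (trans (~-elim (central (elementary x x)) x)
          (trans (cong (λ m → app m f) (elementary-hit x x)) fx))
... | ()

-- If `f` moves `x`, the previous lemma applies. If `f` fixes `x`, the witness is `elementary x z`:
-- after `f` it sends `x` to `z`, before `f` it leads to `z`, where `f` is undefined.
partial⇒noncentral : ∀ {f : PT n} {x y z} → lookup f x ≡ just y → lookup f z ≡ nothing → ¬ Central f
partial⇒noncentral {f = f} {x} {y} {z} fx fz with y ≟ x
... | no y≢x = moves⇒noncentral fx y≢x
... | yes refl = λ central → case-⊥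
  (trans (sym (trans (cong (λ m → app m (elementary y z)) fx) (elementary-hit y z)))
         (trans (~-elim (central (elementary y z)) y)
           (trans (cong (λ m → app m f) (elementary-hit y z)) fz)))
  where
  case-⊥ : just z ≡ nothing → ⊥
  case-⊥ ()

total-noncentral : ∀ (h : Fin n → Fin n) {x} → h x ≢ x → ¬ Central (total h)
total-noncentral h {x} = moves⇒noncentral (lookup-total h x)

-- Partial identities and bounded walks.

idOn : (Fin n → Bool) → PT n
idOn A = tabulate λ x → if A x then just x else nothing

lookup-idOn : ∀ (A : Fin n → Bool) x → lookup (idOn A) x ≡ (if A x then just x else nothing)
lookup-idOn A = Vec.lookup∘tabulate _

Proper : (Fin n → Bool) → Set
Proper A = (∃ λ x → A x ≡ true) × (∃ λ x → A x ≡ false)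

idOn-noncentral : ∀ {A : Fin n → Bool} → Proper A → ¬ Central (idOn A)
idOn-noncentral {A = A} ((x , Ax) , (z , Az)) = partial⇒noncentral
  (trans (lookup-idOn A x) (cong (if_then just x else nothing) Ax))
  (trans (lookup-idOn A z) (cong (if_then just z else nothing) Az))

-- When no arrow of `f` enters or leaves `A`, restricting `f` by sources or by targets gives the
-- same map.
~-idOn : ∀ {f : PT n} {A} → (∀ {x y} → lookup f x ≡ just y → A x ≡ A y) → f ~ idOn A
~-idOn {f = f} {A} inv = ~-intro pointwise
  where
  pointwise : ∀ x → app (lookup f x) (idOn A) ≡ app (lookup (idOn A) x) f
  pointwise x rewrite lookup-idOn A x with lookup f x in fx
  ... | nothing with A x
  ...   | true  = sym fx
  ...   | false = refl
  pointwise x | just y rewrite lookup-idOn A y | sym (inv fx) with A x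
  ...   | true  = sym fx
  ...   | false = refl

total-~-idOn : ∀ {h : Fin n → Fin n} {A} → (∀ x → A x ≡ A (h x)) → total h ~ idOn A
total-~-idOn {h = h} {A} inv = ~-idOn λ {x} fx →
  trans (inv x) (cong A (just-injective (trans (sym (lookup-total h x)) fx)))

idOn-~-idOn : ∀ (A B : Fin n → Bool) → idOn A ~ idOn B
idOn-~-idOn A B = ~-idOn λ {x} eq → cong B (fixes x eq)
  where
  fixes : ∀ x {y} → lookup (idOn A) x ≡ just y → x ≡ y
  fixes x eq with A x | trans (sym (lookup-idOn A x)) eq
  ... | true  | refl = refl
  ... | false | ()

-- Adjacency excludes equal vertices, commutation does not. If `u` and `v` coincide the step is
-- dropped, so paths can be given as chains of commuting maps without checking distinctness.
~⇒DistLe : ∀ {u v w : Vertex n} {k} → proj₁ u ~ proj₁ v → DistLe v w k → DistLe u w (suc k)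
~⇒DistLe {u = u} {v} uv (m , m≤k , walk) with Vec.≡-dec (Maybe-≟ _≟_) (proj₁ u) (proj₁ v)
... | yes refl = m , ℕ.m≤n⇒m≤1+n m≤k , walk
... | no  u≢v  = suc m , s≤s m≤k , step (u≢v , uv) walk

DistLe-refl : ∀ {u : Vertex n} → DistLe u u 0
DistLe-refl = 0 , z≤n , here

Walk-trans : ∀ {u v w : Vertex n} {i j} → Walk u v i → Walk v w j → Walk u w (i + j)
Walk-trans here       q = q
Walk-trans (step a p) q = step a (Walk-trans p q)

Walk-sym : ∀ {u v : Vertex n} {i} → Walk u v i → Walk v u i
Walk-sym here = here
Walk-sym {i = suc i} (step (u≢v , uv) p) =
  subst (Walk _ _) (ℕ.+-comm i 1) (Walk-trans (Walk-sym p) (step (u≢v ∘ sym , sym uv) here))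

DistLe-trans : ∀ {u v w : Vertex n} {i j} → DistLe u v i → DistLe v w j → DistLe u w (i + j)
DistLe-trans (a , a≤i , p) (b , b≤j , q) = a + b , ℕ.+-mono-≤ a≤i b≤j , Walk-trans p q

DistLe-sym : ∀ {u v : Vertex n} {i} → DistLe u v i → DistLe v u i
DistLe-sym (a , a≤i , p) = a , a≤i , Walk-sym p

DistLe-mono : ∀ {u v : Vertex n} {i j} → i ≤ j → DistLe u v i → DistLe u v j
DistLe-mono i≤j (a , a≤i , p) = a , ℕ.≤-trans a≤i i≤j , p

-- Elementary maps, constants and maps merging two points.

missed : ∀ {k n} → k < n → (g : Fin k → Fin n) → ∃ λ y → ∀ i → g i ≢ y
missed k<n g with any? (λ y → all? (λ i → ¬? (g i ≟ y)))
... | yes found = found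
... | no  none  = contradiction (injective⇒≤ section-injective) (ℕ.<⇒≱ k<n)
  where
  preimage : ∀ y → ∃ λ i → g i ≡ y
  preimage y = decidable-stable (any? λ i → g i ≟ y) λ ∄i → none (y , λ i gi → ∄i (i , gi))
  section-injective : ∀ {x y} → proj₁ (preimage x) ≡ proj₁ (preimage y) → x ≡ y
  section-injective {x} {y} eq =
    trans (sym (proj₂ (preimage x))) (trans (cong g eq) (proj₂ (preimage y)))

avoid₂ : 3 ≤ n → (a b : Fin n) → ∃ λ y → y ≢ a × y ≢ b
avoid₂ 3≤n a b with missed 3≤n (lookup (a ∷ b ∷ []))
... | y , y∉ = y , y∉ 0F ∘ sym , y∉ 1F ∘ sym

-- If `f` were onto, a choice of preimages would avoid `b`; punching `b` out would inject `suc n`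
-- points into `n`.
undefined⇒not-onto : ∀ {f : PT n} {b} → lookup f b ≡ nothing → ∃ λ a → ∀ x → lookup f x ≢ just a
undefined⇒not-onto {suc n} {f} {b} fb
  with any? (λ a → all? (λ x → ¬? (Maybe-≟ _≟_ (lookup f x) (just a))))
... | yes found = found
... | no  none  = contradiction (injective⇒≤ punched-injective) ℕ.1+n≰n
  where
  preimage : ∀ a → ∃ λ x → lookup f x ≡ just a
  preimage a = decidable-stable (any? λ x → Maybe-≟ _≟_ (lookup f x) (just a))
    λ ∄x → none (a , λ x fx → ∄x (x , fx))
  b≢ : ∀ a → b ≢ proj₁ (preimage a)
  b≢ a eq with trans (sym fb) (trans (cong (lookup f) eq) (proj₂ (preimage a)))
  ... | ()
  punched-injective : ∀ {x y} → punchOut (b≢ x) ≡ punchOut (b≢ y) → x ≡ y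
  punched-injective {x} {y} eq = just-injective
    (trans (sym (proj₂ (preimage x)))
      (trans (cong (lookup f) (punchOut-injective (b≢ x) (b≢ y) eq)) (proj₂ (preimage y))))

elementary-inv : ∀ {a b x y : Fin n} → lookup (elementary a b) x ≡ just y → x ≡ a × b ≡ y
elementary-inv {a = a} {b} {x} eq with x ≟ a
... | yes refl = refl , just-injective (trans (sym (elementary-hit a b)) eq)
... | no  x≢a with trans (sym (elementary-miss a b x≢a)) eq
...   | ()

-- Both products are empty: `f` never reaches `a`, the whole domain of the elementary map, and is
-- undefined at `b`, its only value.
~-elementary : ∀ {f : PT n} {a b} → (∀ x → lookup f x ≢ just a) → lookup f b ≡ nothing → f ~ elementary a b
~-elementary {f = f} {a} {b} a∉im b∉dom = ~-intro λ x →
  trans (app-elementary-miss a b (a∉im x)) (sym (absorbed x))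
  where
  absorbed : ∀ x → app (lookup (elementary a b) x) f ≡ nothing
  absorbed x with lookup (elementary a b) x in eq
  ... | nothing = refl
  ... | just y  = subst (λ z → lookup f z ≡ nothing) (proj₂ (elementary-inv {a = a} {b} {x} eq)) b∉dom

elementary-noncentral : 3 ≤ n → (a b : Fin n) → ¬ Central (elementary a b)
elementary-noncentral 3≤n a b with avoid₂ 3≤n a b
... | z , z≢a , _ = partial⇒noncentral (elementary-hit a b) (elementary-miss a b z≢a)

single : Fin n → Fin n → Bool
single y x = does (x ≟ y)

single-proper : ∀ {y z : Fin n} → z ≢ y → Proper (single y)
single-proper {y = y} {z} z≢y = (y , dec-true (y ≟ y) refl) , (z , dec-false (z ≟ y) z≢y)

elementary-~-single : ∀ {a b y : Fin n} → y ≢ a → y ≢ b → elementary a b ~ idOn (single y)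
elementary-~-single {a = a} {b} {y} y≢a y≢b = ~-idOn λ {x} {z} eq →
  helper (elementary-inv {a = a} {b} {x} eq)
  where
  helper : ∀ {x z} → x ≡ a × b ≡ z → single y x ≡ single y z
  helper (refl , refl) = trans (dec-false (a ≟ y) (y≢a ∘ sym)) (sym (dec-false (b ≟ y) (y≢b ∘ sym)))

constant : Fin n → PT n
constant r = total λ _ → r

constant-noncentral : 3 ≤ n → (r : Fin n) → ¬ Central (constant r)
constant-noncentral 3≤n r with avoid₂ 3≤n r r
... | z , z≢r , _ = total-noncentral (λ _ → r) {z} (z≢r ∘ sym)

move : Fin n → Fin n → Fin n → Fin n
move a b x = if does (x ≟ a) then b else x

move-hit : ∀ (a b : Fin n) → move a b a ≡ b
move-hit a b = cong (if_then b else a) (dec-true (a ≟ a) refl)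

move-miss : ∀ (a b : Fin n) {x} → x ≢ a → move a b x ≡ x
move-miss a b {x} x≢a = cong (if_then b else x) (dec-false (x ≟ a) x≢a)

move-noncentral : ∀ {a b : Fin n} → a ≢ b → ¬ Central (total (move a b))
move-noncentral {a = a} {b} a≢b = total-noncentral (move a b) {a} λ eq → a≢b (trans (sym eq) (move-hit a b))

move-~-constant : ∀ {a b r : Fin n} → a ≢ r → total (move a b) ~ constant r
move-~-constant {a = a} {b} {r} a≢r = total-~ (move a b) (λ _ → r) λ _ → move-miss a b (a≢r ∘ sym)

move-~-idOn : ∀ {a b : Fin n} {A} → A a ≡ A b → total (move a b) ~ idOn A
move-~-idOn {a = a} {b} {A} Aa≡Ab = total-~-idOn same
  where
  same : ∀ x → A x ≡ A (move a b x)
  same x with x ≟ a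
  ... | yes refl = Aa≡Ab
  ... | no  _    = refl

-- Idempotent powers and orbits.

∣n! : ∀ {d} → 0 < d → d ≤ n → d ∣ n !
∣n! {d = suc d} _ d≤n = ∣-trans (m∣m*n (d !)) (m≤n⇒m!∣n! d≤n)

n≤n! : ∀ n → n ≤ n !
n≤n! zero    = z≤n
n≤n! (suc n) = ∣⇒≤ {{suc n ℕ.!≢0}} (∣n! z<s ℕ.≤-refl)

-- The exponent is `n !`. Two of the iterates 0 to `n` of `x` agree, say at `i < j`. As `n !` is at
-- least `i` and a multiple of `j - i`, the iterate `n !` of `x` lies on a cycle and is fixed by
-- `h ^ n !`.
idempotent-power : ∀ (h : Fin n → Fin n) →
  ∃ λ M → ∀ x → (h ^ suc M) ((h ^ suc M) x) ≡ (h ^ suc M) x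
idempotent-power {n} h with n ! | ℕ.1≤n! n | n≤n! n | (λ {d} → ∣n! {n} {d})
... | suc M | _ | n≤N | dvd = M , idem
  where
  idem : ∀ x → (h ^ suc M) ((h ^ suc M) x) ≡ (h ^ suc M) x
  idem x with pigeonhole (ℕ.n<1+n n) (λ i → (h ^ toℕ i) x)
  ... | i , j , i<j , eq
    with divides q N≡ ← dvd {toℕ j ∸ toℕ i} (ℕ.m<n⇒0<n∸m i<j)
                            (ℕ.≤-trans (ℕ.m∸n≤m (toℕ j) (toℕ i)) (ℕ.≤-pred (toℕ<n j)))
    = begin
      (h ^ suc M) w       ≡⟨ cong (λ k → (h ^ k) w) N≡ ⟩
      (h ^ (q * d)) w     ≡⟨ ^-* h q d w ⟩
      ((h ^ d) ^ q) w     ≡⟨ ^-fixed (h ^ d) q periodic ⟩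
      w                   ∎
    where
    open ≡-Reasoning
    d = toℕ j ∸ toℕ i
    r = suc M ∸ toℕ i
    w = (h ^ suc M) x
    i≤N : toℕ i ≤ suc M
    i≤N = ℕ.≤-trans (ℕ.≤-pred (toℕ<n i)) n≤N
    w≡ : w ≡ (h ^ r) ((h ^ toℕ i) x)
    w≡ = trans (cong (λ k → (h ^ k) x) (sym (ℕ.m∸n+n≡m i≤N))) (^-+ h r (toℕ i) x)
    periodic : (h ^ d) w ≡ w
    periodic = begin
      (h ^ d) w                          ≡⟨ cong (h ^ d) w≡ ⟩
      (h ^ d) ((h ^ r) ((h ^ toℕ i) x))  ≡⟨ ^-swap h d r _ ⟩
      (h ^ r) ((h ^ d) ((h ^ toℕ i) x))  ≡⟨ cong (h ^ r) (sym (^-+ h d (toℕ i) x)) ⟩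
      (h ^ r) ((h ^ (d + toℕ i)) x)      ≡⟨ cong (λ k → (h ^ r) ((h ^ k) x)) (ℕ.m∸n+n≡m (ℕ.<⇒≤ i<j)) ⟩
      (h ^ r) ((h ^ toℕ j) x)            ≡⟨ cong (h ^ r) (sym eq) ⟩
      (h ^ r) ((h ^ toℕ i) x)            ≡⟨ sym w≡ ⟩
      w                                  ∎

module Orbit (h : Fin n → Fin n) (h-injective : ∀ {x y} → h x ≡ h y → x ≡ y) (x₀ : Fin n) where

  orbit? : ∀ p x → Dec (∃ λ (i : Fin p) → (h ^ toℕ i) x₀ ≡ x)
  orbit? p x = any? λ i → (h ^ toℕ i) x₀ ≟ x

  orbit : ℕ → Fin n → Bool
  orbit p x = does (orbit? p x)

  -- Closing up after `suc p` steps lets exponents be reduced modulo `suc p`, so the set is stable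
  -- under `h`; injectivity makes it stable under preimages too.
  orbit-~ : ∀ p → (h ^ suc p) x₀ ≡ x₀ → total h ~ idOn (orbit (suc p))
  orbit-~ p closed = total-~-idOn λ x → does-⇔ (mk⇔ forward backward) (orbit? (suc p) x) (orbit? (suc p) (h x))
    where
    In : Fin n → Set
    In x = ∃ λ (i : Fin (suc p)) → (h ^ toℕ i) x₀ ≡ x
    reduce : ∀ i → In ((h ^ i) x₀)
    reduce i = fromℕ< (m%n<n i (suc p)) , (begin
      (h ^ toℕ (fromℕ< (m%n<n i (suc p)))) x₀             ≡⟨ cong (λ k → (h ^ k) x₀) (toℕ-fromℕ< (m%n<n i (suc p))) ⟩
      (h ^ (i % suc p)) x₀                                 ≡⟨ cong (h ^ (i % suc p)) (sym (^-fixed (h ^ suc p) (i / suc p) closed)) ⟩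
      (h ^ (i % suc p)) (((h ^ suc p) ^ (i / suc p)) x₀)   ≡⟨ cong (h ^ (i % suc p)) (sym (^-* h (i / suc p) (suc p) x₀)) ⟩
      (h ^ (i % suc p)) ((h ^ (i / suc p * suc p)) x₀)     ≡⟨ sym (^-+ h (i % suc p) _ x₀) ⟩
      (h ^ (i % suc p + i / suc p * suc p)) x₀             ≡⟨ cong (λ k → (h ^ k) x₀) (sym (m≡m%n+[m/n]*n i (suc p))) ⟩
      (h ^ i) x₀                                           ∎)
      where open ≡-Reasoning
    forward : ∀ {x} → In x → In (h x)
    forward (i , refl) = reduce (suc (toℕ i))
    backward : ∀ {x} → In (h x) → In x
    -- Here `h x` is `x₀`, which is also the image of the orbit point with exponent `p`; so `x` is
    -- that point.
    backward {x} (zero  , eq) = subst In (h-injective (trans closed eq)) (reduce p)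
    backward {x} (suc i , eq) = subst In (h-injective eq) (reduce (toℕ i))

  orbit-proper : ∀ p → suc p < n → Proper (orbit (suc p))
  orbit-proper p p<n with missed p<n (λ i → (h ^ toℕ i) x₀)
  ... | b , b∉ = (x₀ , dec-true (orbit? (suc p) x₀) (zero , refl)) , (b , dec-false (orbit? (suc p) b) λ (i , eq) → b∉ i eq)

-- The upper bound 5 for composite n.

data Shape (u : Vertex n) : Set where
  near-idOn : ∀ {A} (proper : Proper A) → DistLe u (idOn A , idOn-noncentral proper) 2 → Shape u
  near-constant : ∀ {r} → proj₁ u ~ constant r → Shape u

-- The path is `f`, `elementary a b`, identity on `y`: here `a` is a point missed by `f`, and `y` is
-- a third point.
partial-shape : 3 ≤ n → ∀ (u : Vertex n) {b} → lookup (proj₁ u) b ≡ nothing → Shape u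
partial-shape 3≤n u@(f , _) {b} fb with undefined⇒not-onto {f = f} fb
... | a , a∉im with avoid₂ 3≤n a b
...   | y , y≢a , y≢b = near-idOn (single-proper (y≢a ∘ sym))
        (~⇒DistLe {v = elementary a b , elementary-noncentral 3≤n a b} (~-elementary {f = f} a∉im fb)
        (~⇒DistLe (elementary-~-single y≢a y≢b) DistLe-refl))

composite-factors : Composite n → ∃₂ λ m d → suc m < n × suc d < n × n ≡ suc m * suc d
composite-factors (hasNonTrivialDivisor {suc d} d<n (divides (suc m) refl)) =
  m , d , ℕ.m<m*n (suc m) (suc d) (nonTrivial⇒n>1 (suc d)) , d<n , refl
composite-factors (hasNonTrivialDivisor {zero} {{()}} d<n d∣n)
composite-factors (hasNonTrivialDivisor {suc d} () (divides zero refl))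

-- A period of `zero` smaller than the number of points gives a proper orbit at once. Otherwise
-- `zero` returns after as many steps as there are points, `suc m * suc d`: then either `suc d`
-- steps already suffice, or `h ^ suc d` is a noncentral map commuting with `h` whose orbit closes
-- after `suc m` steps.
permutation-shape : Composite n → ∀ (h : Fin n → Fin n) → (∀ {x y} → h x ≡ h y → x ≡ y) →
                    (u : Vertex n) → proj₁ u ≡ total h → Shape u
permutation-shape {suc n} comp h inj u refl
  with pigeonhole (ℕ.n<1+n (suc n)) (λ i → (h ^ toℕ i) zero)
... | i , j , i<j , eq with toℕ j ∸ toℕ i in p≡
...   | zero = contradiction (ℕ.m∸n≡0⇒m≤n p≡) (ℕ.<⇒≱ i<j)
...   | suc p = by-period (suc p ℕ.≟ suc n)
  where
  open Orbit
  p≤n : suc p ≤ suc n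
  p≤n = subst (_≤ suc n) p≡ (ℕ.≤-trans (ℕ.m∸n≤m (toℕ j) (toℕ i)) (ℕ.≤-pred (toℕ<n j)))
  closed : (h ^ suc p) zero ≡ zero
  -- Cancelling `i` applications of `h` turns the collision of two iterates into a return to `zero`.
  closed = ^-injective inj (toℕ i) (trans (sym (^-+ h (toℕ i) (suc p) zero))
    (trans (cong (λ k → (h ^ k) zero) (trans (cong (toℕ i +_) (sym p≡)) (ℕ.m+[n∸m]≡n (ℕ.<⇒≤ i<j)))) (sym eq)))
  short : ∀ q → suc q < suc n → (h ^ suc q) zero ≡ zero → Shape u
  short q q<n e = near-idOn (orbit-proper h inj zero q q<n)
    (DistLe-mono (s≤s z≤n) (~⇒DistLe (orbit-~ h inj zero q e) DistLe-refl))
  by-period : Dec (suc p ≡ suc n) → Shape u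
  by-period (no p≢n) = short p (ℕ.≤∧≢⇒< p≤n p≢n) closed
  by-period (yes p≡n) with composite-factors comp
  ... | m , d , m<n , d<n , n≡m*d with (h ^ suc d) zero ≟ zero
  ...   | yes e = short d d<n e
  ...   | no  e = near-idOn (orbit-proper g g-injective zero m m<n)
            (~⇒DistLe {v = total g , total-noncentral g e} (total-~ h g λ x → sym (^-comm h (suc d) x))
            (~⇒DistLe (orbit-~ g g-injective zero m g-closed) DistLe-refl))
    where
    g = h ^ suc d
    g-injective : ∀ {x y} → g x ≡ g y → x ≡ y
    g-injective = ^-injective inj (suc d)
    g-closed : (g ^ suc m) zero ≡ zero
    g-closed = trans (sym (^-* h (suc m) (suc d) zero))
      (trans (cong (λ k → (h ^ k) zero) (trans (sym n≡m*d) (sym p≡n))) closed)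

-- The idempotent power `e` of `h` decides. If `e` is constant, `h` fixes its value; if `e` is the
-- identity, `h` is a permutation; otherwise `e` is a vertex, and idempotence makes its fibre over
-- `e zero` a proper invariant set.
total-shape : 3 ≤ n → Composite n → ∀ (h : Fin n → Fin n) (u : Vertex n) → proj₁ u ≡ total h → Shape u
total-shape {suc n} 3≤n comp h u refl with idempotent-power h
... | M , idem with all? (λ x → (h ^ suc M) x ≟ (h ^ suc M) zero)
...   | yes const = near-constant {r = (h ^ suc M) zero}
          (total-~ h (λ _ → (h ^ suc M) zero) λ x → trans (sym (^-comm h (suc M) zero)) (const (h zero)))
...   | no nonconst with all? (λ x → (h ^ suc M) x ≟ x)
...     | yes fixed = permutation-shape comp h
            -- Since `h ^ suc M` is the identity, `h ^ M` is a left inverse of `h`.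
            (λ {x} {y} eq → trans (sym (fixed x)) (trans (sym (^-comm h M x))
              (trans (cong (h ^ M) eq) (trans (^-comm h M y) (fixed y))))) u refl
...     | no moving = near-idOn kernel-proper
            (~⇒DistLe {v = total e , total-noncentral e (proj₂ moved)} (total-~ h e λ x → sym (^-comm h (suc M) x))
            (~⇒DistLe (total-~-idOn λ x → cong (λ y → does (y ≟ e zero)) (sym (idem x))) DistLe-refl))
  where
  e = h ^ suc M
  moved = ¬∀⟶∃¬ (suc n) (λ x → e x ≡ x) (λ x → e x ≟ x) moving
  outside = ¬∀⟶∃¬ (suc n) (λ x → e x ≡ e zero) (λ x → e x ≟ e zero) nonconst
  kernel-proper : Proper λ x → does (e x ≟ e zero)
  kernel-proper = (zero , dec-true (e zero ≟ e zero) refl) ,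
                  (proj₁ outside , dec-false (e (proj₁ outside) ≟ e zero) (proj₂ outside))

everywhere-defined⇒total : ∀ {f : PT n} → (∀ x → lookup f x ≢ nothing) → ∃ λ h → f ≡ total h
everywhere-defined⇒total {f = f} defined =
  (proj₁ ∘ value) , ext λ x → trans (proj₂ (value x)) (sym (lookup-total (proj₁ ∘ value) x))
  where
  value : ∀ x → ∃ λ y → lookup f x ≡ just y
  value x with lookup f x in fx
  ... | just y  = y , refl
  ... | nothing = contradiction fx (defined x)

shape : 3 ≤ n → Composite n → ∀ (u : Vertex n) → Shape u
shape 3≤n comp u@(f , _) with any? (λ x → Maybe-≟ _≟_ (lookup f x) nothing)
... | yes (b , fb) = partial-shape 3≤n u fb
... | no  defined with everywhere-defined⇒total {f = f} (λ x fx → defined (x , fx))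
...   | h , f≡h = total-shape 3≤n comp h u f≡h

-- Of three points, two lie on the same side of `A`; at least one of these two differs from `r` and
-- is taken as `a`.
mergeable : 3 ≤ n → ∀ (A : Fin n → Bool) r → ∃₂ λ a b → a ≢ b × a ≢ r × A a ≡ A b
mergeable (s≤s (s≤s (s≤s _))) A r = avoiding two-alike
  where
  two-alike : ∃₂ λ a b → a ≢ b × A a ≡ A b
  two-alike with A 0F Bool.≟ A 1F | A 0F Bool.≟ A 2F
  ... | yes eq | _      = 0F , 1F , (λ ()) , eq
  ... | no _   | yes eq = 0F , 2F , (λ ()) , eq
  ... | no neq | no neq′ = 1F , 2F , (λ ()) , trans (Bool.¬-not (neq ∘ sym)) (sym (Bool.¬-not (neq′ ∘ sym)))
  avoiding : (∃₂ λ a b → a ≢ b × A a ≡ A b) → ∃₂ λ a b → a ≢ b × a ≢ r × A a ≡ A b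
  avoiding (a , b , a≢b , eq) with a ≟ r
  ... | no  a≢r  = a , b , a≢b , a≢r , eq
  ... | yes refl = b , a , a≢b ∘ sym , a≢b ∘ sym , sym eq

-- The connecting map `move a b` fixes `r`, hence commutes with the constant, and merges two points
-- on the same side of `A`, hence commutes with `idOn A`.
constant-to-idOn : 3 ≤ n → ∀ {u : Vertex n} {r A} (proper : Proper A) → proj₁ u ~ constant r →
                   DistLe u (idOn A , idOn-noncentral proper) 3
constant-to-idOn 3≤n {r = r} {A} proper u~r with mergeable 3≤n A r
... | a , b , a≢b , a≢r , Aa≡Ab =
  ~⇒DistLe {v = constant r , constant-noncentral 3≤n r} u~r
  (~⇒DistLe {v = total (move a b) , move-noncentral a≢b} (sym (move-~-constant a≢r))
  (~⇒DistLe (move-~-idOn Aa≡Ab) DistLe-refl))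

-- Two partial identities commute, which gives 2 + 1 + 2; a constant on one side only gives 3 + 2.
distance≤5 : 3 ≤ n → Composite n → ∀ (u v : Vertex n) → DistLe u v 5
distance≤5 3≤n comp u v with shape 3≤n comp u | shape 3≤n comp v
... | near-idOn pA uA | near-idOn pB vB =
  DistLe-trans uA (~⇒DistLe (idOn-~-idOn _ _) (DistLe-sym vB))
... | near-idOn pA uA | near-constant v~s =
  DistLe-trans uA (DistLe-sym (constant-to-idOn 3≤n pA v~s))
... | near-constant u~r | near-idOn pB vB =
  DistLe-trans (constant-to-idOn 3≤n pB u~r) (DistLe-sym vB)
... | near-constant {r} u~r | near-constant {s} v~s with avoid₂ 3≤n r s
-- `move a r` fixes both `r` and `s`, so it commutes with both constants and length 4 suffices.
...   | a , a≢r , a≢s =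
  DistLe-mono (ℕ.n≤1+n 4)
  (~⇒DistLe {v = constant r , constant-noncentral 3≤n r} u~r
  (~⇒DistLe {v = total (move a r) , move-noncentral a≢r} (sym (move-~-constant a≢r))
  (~⇒DistLe {v = constant s , constant-noncentral 3≤n s} (move-~-constant a≢s)
  (~⇒DistLe (sym v~s) DistLe-refl))))

-- Maps with a generating point and their centralizers.

Generates : (Fin n → Fin n) → Fin n → Set
Generates {n} h t = ∀ x → ∃ λ (i : Fin n) → (h ^ toℕ i) t ≡ x

-- Equivariance determines `f` by its value at `t`: if undefined there, `f` is empty; if the value
-- is the `i`-th iterate of `t`, then `f` is the `i`-th power of `h`.
centralizer-of-generated : ∀ {h : Fin n → Fin n} {t f} → Generates h t → ¬ Central f → f ~ total h →
                           ∃ λ (i : Fin n) → f ≡ total (h ^ toℕ i)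
centralizer-of-generated {h = h} {t} {f} gen f≁ fh with lookup f t in ft
... | nothing = contradiction (nowhere⇒central nowhere) f≁
  where
  nowhere : ∀ x → lookup f x ≡ nothing
  nowhere x with gen x
  ... | i , refl = trans (equivariant-^ {f = f} (~⇒equivariant fh) (toℕ i) t) (cong (Maybe.map (h ^ toℕ i)) ft)
... | just y with gen y
...   | i , refl = i , ext λ x → trans (value x (gen x)) (sym (lookup-total (h ^ toℕ i) x))
  where
  value : ∀ x → (∃ λ j → (h ^ toℕ j) t ≡ x) → lookup f x ≡ just ((h ^ toℕ i) x)
  value x (j , refl) = begin
    lookup f ((h ^ toℕ j) t)             ≡⟨ equivariant-^ {f = f} (~⇒equivariant fh) (toℕ j) t ⟩
    Maybe.map (h ^ toℕ j) (lookup f t)   ≡⟨ cong (Maybe.map (h ^ toℕ j)) ft ⟩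
    just ((h ^ toℕ j) ((h ^ toℕ i) t))   ≡⟨ cong just (^-swap h (toℕ j) (toℕ i) t) ⟩
    just ((h ^ toℕ i) ((h ^ toℕ j) t))   ∎
    where open ≡-Reasoning

total-identity : ∀ {h : Fin n → Fin n} → (∀ x → h x ≡ x) → Central (total h)
total-identity {h = h} fixed = identity⇒central λ x → trans (lookup-total h x) (cong just (fixed x))

-- The path from `m` down to 0, closed by an arrow from 0 to `b`: a cycle on 0 to `b` with a tail
-- running into it. The extreme cases are a full cycle and a path into a fixed point.
descend : Fin (suc m) → Fin (suc m) → Fin (suc m)
descend b zero    = b
descend b (suc j) = inject₁ j

toℕ-descend^ : ∀ (b : Fin (suc m)) i j → i ≤ toℕ j → toℕ ((descend b ^ i) j) ≡ toℕ j ∸ i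
toℕ-descend^ b zero    j _   = refl
toℕ-descend^ b (suc i) j i<j with (descend b ^ i) j | toℕ-descend^ b i j (ℕ.<⇒≤ i<j)
... | zero  | eq = contradiction (ℕ.m∸n≡0⇒m≤n (sym eq)) (ℕ.<⇒≱ i<j)
... | suc x | eq = trans (Fin.toℕ-inject₁ x) (trans (cong pred eq) (ℕ.pred[m∸n]≡m∸[1+n] (toℕ j) i))

descend-generates : ∀ (b : Fin (suc m)) → Generates (descend b) (fromℕ m)
descend-generates {m} b x = fromℕ< i<n , Fin.toℕ-injective (begin
  toℕ ((descend b ^ toℕ (fromℕ< i<n)) (fromℕ m))  ≡⟨ cong (λ i → toℕ ((descend b ^ i) (fromℕ m))) (Fin.toℕ-fromℕ< i<n) ⟩
  toℕ ((descend b ^ (m ∸ toℕ x)) (fromℕ m))       ≡⟨ toℕ-descend^ b (m ∸ toℕ x) (fromℕ m) (subst (m ∸ toℕ x ≤_) (sym (Fin.toℕ-fromℕ m)) (ℕ.m∸n≤m m (toℕ x))) ⟩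
  toℕ (fromℕ m) ∸ (m ∸ toℕ x)                     ≡⟨ cong (_∸ (m ∸ toℕ x)) (Fin.toℕ-fromℕ m) ⟩
  m ∸ (m ∸ toℕ x)                                 ≡⟨ ℕ.m∸[m∸n]≡n (Fin.toℕ≤pred[n] x) ⟩
  toℕ x                                           ∎)
  where
  open ≡-Reasoning
  i<n : m ∸ toℕ x < suc m
  i<n = s≤s (ℕ.m∸n≤m m (toℕ x))

-- From `j`, it takes `j` steps to reach 0, one to jump to `b`, and `b - j` to come back.
descend^-period : ∀ (b j : Fin (suc m)) → toℕ j ≤ toℕ b → (descend b ^ suc (toℕ b)) j ≡ j
descend^-period b j j≤b = Fin.toℕ-injective (begin
  toℕ ((descend b ^ suc (toℕ b)) j)                            ≡⟨ cong (λ i → toℕ ((descend b ^ i) j)) split ⟩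
  toℕ ((descend b ^ (toℕ b ∸ toℕ j + suc (toℕ j))) j)          ≡⟨ cong toℕ (^-+ (descend b) (toℕ b ∸ toℕ j) (suc (toℕ j)) j) ⟩
  toℕ ((descend b ^ (toℕ b ∸ toℕ j)) ((descend b ^ suc (toℕ j)) j)) ≡⟨ cong (toℕ ∘ (descend b ^ (toℕ b ∸ toℕ j))) (cong (descend b) bottom) ⟩
  toℕ ((descend b ^ (toℕ b ∸ toℕ j)) b)                        ≡⟨ toℕ-descend^ b _ b (ℕ.m∸n≤m (toℕ b) (toℕ j)) ⟩
  toℕ b ∸ (toℕ b ∸ toℕ j)                                      ≡⟨ ℕ.m∸[m∸n]≡n j≤b ⟩
  toℕ j                                                        ∎)
  where
  open ≡-Reasoning
  split : suc (toℕ b) ≡ toℕ b ∸ toℕ j + suc (toℕ j)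
  split = sym (trans (ℕ.+-suc _ (toℕ j)) (cong suc (ℕ.m∸n+n≡m j≤b)))
  bottom : (descend b ^ toℕ j) j ≡ zero
  bottom = Fin.toℕ-injective (trans (toℕ-descend^ b (toℕ j) j ℕ.≤-refl) (ℕ.n∸n≡0 (toℕ j)))

-- Prime n: the powers of a full cycle.

cycle : Fin (suc m) → Fin (suc m)
cycle = descend (fromℕ _)

cycle-period : ∀ (x : Fin (suc m)) → (cycle ^ suc m) x ≡ x
cycle-period {m} x = trans (cong (λ k → (cycle ^ suc k) x) (sym (Fin.toℕ-fromℕ m)))
  (descend^-period (fromℕ m) x (subst (toℕ x ≤_) (sym (Fin.toℕ-fromℕ m)) (Fin.toℕ≤pred[n] x)))

-- A nontrivial power of a cycle of prime length generates the cycle.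
commutes-with-cycle : Prime (suc m) → ∀ {u v : PT (suc m)} → ¬ Central u → u ~ total cycle → v ~ u → v ~ total cycle
commutes-with-cycle {m} pr {u} {v} u≁ uc vu with centralizer-of-generated {f = u} (descend-generates (fromℕ m)) u≁ uc
... | zero , refl = contradiction (total-identity λ _ → refl) u≁
... | suc i , refl = equivariant⇒~ {f = v} (from-bézout (coprime-Bézout (prime⇒coprime pr (s<s (Fin.toℕ<n i)))))
  where
  k = suc (toℕ i)
  powers : ∀ j → Equivariant (cycle ^ (j * k)) v
  powers j = equivariant-cong {f = v} (λ x → sym (^-* cycle j k x)) (equivariant-^ {f = v} (~⇒equivariant vu) j)
  wraps : ∀ j x → (cycle ^ suc (j * suc m)) x ≡ cycle x
  wraps j x = cong cycle (trans (^-* cycle j (suc m) x) (^-fixed (cycle ^ suc m) j (cycle-period x)))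
  from-bézout : Bézout.Identity 1 (suc m) k → Equivariant cycle v
  -- Here `1 + a * suc m = b * k`, so the power `b * k` is the cycle itself.
  from-bézout (Bézout.-+ a b eq) = equivariant-cong {f = v}
    (λ x → trans (cong (λ j → (cycle ^ j) x) (sym eq)) (wraps a x)) (powers b)
  -- Here `1 + b * k = a * suc m`: the power `w` is the inverse of the cycle, and equivariance under
  -- an inverse is turned around.
  from-bézout (Bézout.+- a b eq) x = begin
    lookup v (cycle x)                                ≡⟨ sym (map-inverse (lookup v (cycle x))) ⟩
    Maybe.map cycle (Maybe.map w (lookup v (cycle x))) ≡⟨ cong (Maybe.map cycle) (sym (powers b (cycle x))) ⟩
    Maybe.map cycle (lookup v (w (cycle x)))          ≡⟨ cong (Maybe.map cycle ∘ lookup v) (trans (^-comm cycle (b * k) x) (inverse x)) ⟩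
    Maybe.map cycle (lookup v x)                      ∎
    where
    open ≡-Reasoning
    w = cycle ^ (b * k)
    inverse : ∀ x → cycle (w x) ≡ x
    inverse x = trans (cong (λ j → (cycle ^ j) x) eq)
      (trans (^-* cycle a (suc m) x) (^-fixed (cycle ^ suc m) a (cycle-period x)))
    map-inverse : ∀ y → Maybe.map cycle (Maybe.map w y) ≡ y
    map-inverse nothing  = refl
    map-inverse (just y) = cong just (inverse y)

-- Commuting with `cycle` propagates along every walk starting at the cycle, but a constant map does
-- not commute with it.
prime⇒disconnected : 2 ≤ n → Prime n → ¬ Connected n
prime⇒disconnected {suc (suc m)} _ pr connected = fixes-zero (stays (proj₂ (connected from to)) refl)
  where
  from to : Vertex (suc (suc m))
  from = total cycle , total-noncentral cycle {zero} λ ()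
  to = constant zero , total-noncentral (λ _ → zero) {suc zero} λ ()
  stays : ∀ {u v k} → Walk u v k → proj₁ u ~ total cycle → proj₁ v ~ total cycle
  stays here uc = uc
  stays {u} (step {v = v} (_ , uv) walk) uc = stays walk (commutes-with-cycle pr {proj₁ u} {proj₁ v} (proj₂ u) uc (sym uv))
  fixes-zero : ¬ (constant zero ~ total cycle)
  fixes-zero eq with total-~-elim (λ _ → zero) cycle eq zero
  ... | ()

-- Lower bounds from idempotent powers.

map-just⁻¹ : ∀ {A B : Set} {h : A → B} {m y} → Maybe.map h m ≡ just y → ∃ λ x → m ≡ just x × h x ≡ y
map-just⁻¹ {m = just x} refl = x , refl , refl

map-nothing⁻¹ : ∀ {A B : Set} {h : A → B} {m} → Maybe.map h m ≡ nothing → m ≡ nothing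
map-nothing⁻¹ {m = nothing} _ = refl

-- A walk of length 0 is padded by staying at `u`, so a distance bound always unfolds into that many
-- commuting steps.
DistLe-uncons : ∀ {u v : Vertex n} {k} → DistLe u v (suc k) →
                ∃ λ (w : Vertex n) → proj₁ u ~ proj₁ w × DistLe w v k
DistLe-uncons {u = u} (zero  , _ , here) = u , refl , (0 , z≤n , here)
DistLe-uncons (suc m , s≤s m≤k , step {v = w} (_ , uw) walk) = w , uw , (m , m≤k , walk)

DistLe-1 : ∀ {u v : Vertex n} → DistLe u v 1 → proj₁ u ~ proj₁ v
DistLe-1 uv with DistLe-uncons uv
... | w , uw , (zero , _ , here) = uw

-- `z` is a power of `h` with positive exponent, and its `M`-th power is a positive power of the
-- idempotent `h ^ M`, hence `h ^ M` itself.
commutes-with-idempotent-power : ∀ {h : Fin n → Fin n} {t} M → Generates h t →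
  (∀ x → (h ^ M) ((h ^ M) x) ≡ (h ^ M) x) →
  ∀ {z y : PT n} → ¬ Central z → total h ~ z → z ~ y → Equivariant (h ^ M) y
commutes-with-idempotent-power {h = h} M gen idem {z} {y} z≁ hz zy
  with centralizer-of-generated {f = z} gen z≁ (sym hz)
... | i , refl with toℕ i
...   | zero  = contradiction (total-identity λ _ → refl) z≁
...   | suc k = equivariant-cong {f = y} collapse (equivariant-^ {f = y} (~⇒equivariant (sym zy)) M)
  where
  powers-idem : ∀ k x → ((h ^ M) ^ suc k) x ≡ (h ^ M) x
  powers-idem zero    x = refl
  powers-idem (suc k) x = trans (cong (h ^ M) (powers-idem k x)) (idem x)
  collapse : ∀ x → ((h ^ suc k) ^ M) x ≡ (h ^ M) x
  collapse x = trans (sym (^-* h M (suc k) x))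
    (trans (cong (λ j → (h ^ j) x) (ℕ.*-comm M (suc k))) (trans (^-* h (suc k) M x) (powers-idem k x)))

module Conjugate (π ρ : Fin n → Fin n) (πρ : ∀ x → π (ρ x) ≡ x) (ρπ : ∀ x → ρ (π x) ≡ x)
                 (h : Fin n → Fin n) where

  conj : Fin n → Fin n
  conj x = π (h (ρ x))

  conj-^ : ∀ i x → (conj ^ i) x ≡ π ((h ^ i) (ρ x))
  conj-^ zero    x = sym (πρ x)
  conj-^ (suc i) x = cong (λ y → π (h y)) (trans (cong ρ (conj-^ i x)) (ρπ _))

  conj-generates : ∀ {t} → Generates h t → Generates conj (π t)
  conj-generates {t} gen x with gen (ρ x)
  ... | i , eq = i , trans (conj-^ (toℕ i) (π t))
                       (trans (cong (λ y → π ((h ^ toℕ i) y)) (ρπ t)) (trans (cong π eq) (πρ x)))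

  conj-idempotent : ∀ M → (∀ x → (h ^ M) ((h ^ M) x) ≡ (h ^ M) x) →
                    ∀ x → (conj ^ M) ((conj ^ M) x) ≡ (conj ^ M) x
  conj-idempotent M idem x = trans (cong (conj ^ M) (conj-^ M x)) (trans (conj-^ M _)
    (trans (cong (π ∘ (h ^ M)) (ρπ _)) (trans (cong π (idem (ρ x))) (sym (conj-^ M x)))))

Rigid : (e e′ : Fin n → Fin n) → Set
Rigid {n} e e′ = ∀ (y : PT n) → Equivariant e y → Equivariant e′ y → Central y

-- The middle vertex of a path of length 4 commutes with a neighbour of each end, hence with both
-- idempotents; rigidity makes it central.
distance≰4 : ∀ {h h′ : Fin n → Fin n} {t t′} M M′ → Generates h t → Generates h′ t′ →
  (∀ x → (h ^ M) ((h ^ M) x) ≡ (h ^ M) x) → (∀ x → (h′ ^ M′) ((h′ ^ M′) x) ≡ (h′ ^ M′) x) →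
  Rigid (h ^ M) (h′ ^ M′) →
  ∀ {u v : Vertex n} → proj₁ u ≡ total h → proj₁ v ≡ total h′ → ¬ DistLe u v 4
distance≰4 M M′ gen gen′ idem idem′ rigid refl refl uv with DistLe-uncons uv
... | (z , z≁) , uz , zv with DistLe-uncons zv
...   | (y , y≁) , zy , yv with DistLe-uncons yv
...     | (z′ , z′≁) , yz′ , z′v = y≁ (rigid y
            (commutes-with-idempotent-power M gen idem {z} {y} z≁ uz zy)
            (commutes-with-idempotent-power M′ gen′ idem′ {z′} {y} z′≁ (sym (DistLe-1 z′v)) (sym yz′)))

-- n at least 7: a rigid pair of idempotents.

module Rotation (m : ℕ) where

  private
    K : ℕ
    K = suc (suc (suc m))

  L : Fin K → Fin K
  L = cycle

  abstract
    -- The inverse of `L`, as its power with exponent `K - 1`. It is sealed because the inverse laws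
    -- are all that is needed later.
    R : Fin K → Fin K
    R = cycle ^ suc (suc m)

    LR : ∀ i → L (R i) ≡ i
    LR = cycle-period

    RL : ∀ i → R (L i) ≡ i
    RL i = trans (^-comm L (suc (suc m)) i) (LR i)

  R-inject₁ : ∀ (i : Fin (suc (suc m))) → R (inject₁ i) ≡ suc i
  R-inject₁ i = RL (suc i)

  R-induction : (P : Fin K → Set) → P zero → (∀ i → P i → P (R i)) → ∀ i → P i
  R-induction P P₀ Pᵣ = <-weakInduction P P₀ λ i Pi → subst P (R-inject₁ i) (Pᵣ (inject₁ i) Pi)

  L≢ : ∀ i → L i ≢ i
  L≢ zero ()
  L≢ (suc i) eq = ℕ.m≢1+m+n (toℕ i) {0} (trans (sym (Fin.toℕ-inject₁ i))
    (trans (cong toℕ eq) (cong suc (sym (ℕ.+-identityʳ (toℕ i))))))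

  -- This is where at least three points are required, so the construction starts at size 3 + 3 + 1.
  LL≢ : ∀ i → L (L i) ≢ i
  LL≢ zero ()
  LL≢ (suc zero) ()
  LL≢ (suc (suc i)) eq = ℕ.m≢1+m+n (toℕ i) {1}
    (trans (trans (sym (Fin.toℕ-inject₁ i)) (sym (Fin.toℕ-inject₁ (inject₁ i))))
      (trans (cong toℕ eq) (cong suc (ℕ.+-comm 1 (toℕ i)))))

  R≢ : ∀ i → R i ≢ i
  R≢ i eq = L≢ i (trans (cong L (sym eq)) (LR i))

  RR≢ : ∀ i → R (R i) ≢ i
  RR≢ i eq = LL≢ i (trans (cong (L ∘ L) (sym eq)) (trans (cong L (LR (R i))) (LR i)))

module Blocks (m : ℕ) (b : Fin 2) where

  open Rotation m

  -- Two blocks of `K` points and `r` extra points, with `r` equal to 1 or 2: every size from 7 on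
  -- has this form.
  K r N : ℕ
  K = suc (suc (suc m))
  r = suc (toℕ b)
  N = K + (K + r)

  r≤K : r ≤ K
  r≤K = s≤s (ℕ.≤-trans (Fin.toℕ≤pred[n] b) (s≤s z≤n))

  p q : Fin K → Fin N
  p i = i ↑ˡ (K + r)
  q i = K ↑ʳ (i ↑ˡ r)

  x : Fin r → Fin N
  x j = K ↑ʳ (K ↑ʳ j)

  ι : Fin r → Fin K
  ι j = inject≤ j r≤K

  data Block : Fin N → Set where
    in-p : ∀ i → Block (p i)
    in-q : ∀ i → Block (q i)
    in-x : ∀ j → Block (x j)

  block : ∀ y → Block y
  block y with splitAt K y in eq
  ... | inj₁ i = subst Block (Fin.splitAt⁻¹-↑ˡ eq) (in-p i)
  ... | inj₂ z with splitAt K z in eq′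
  ...   | inj₁ i = subst Block (trans (cong (K ↑ʳ_) (Fin.splitAt⁻¹-↑ˡ eq′)) (Fin.splitAt⁻¹-↑ʳ {K} eq)) (in-q i)
  ...   | inj₂ j = subst Block (trans (cong (K ↑ʳ_) (Fin.splitAt⁻¹-↑ʳ {K} eq′)) (Fin.splitAt⁻¹-↑ʳ {K} eq)) (in-x j)

  p-injective : ∀ i j → p i ≡ p j → i ≡ j
  p-injective = Fin.↑ˡ-injective (K + r)

  q-injective : ∀ i j → q i ≡ q j → i ≡ j
  q-injective i j eq = Fin.↑ˡ-injective r i j (Fin.↑ʳ-injective K _ _ eq)

  ι-injective : ∀ i j → ι i ≡ ι j → i ≡ j
  ι-injective = Fin.inject≤-injective r≤K r≤K

  module _ (f g : Fin K → Fin N) (h : Fin r → Fin N) where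

    glue : Fin N → Fin N
    glue y = [ f , (λ z → [ g , h ]′ (splitAt K z)) ]′ (splitAt K y)

    glue-p : ∀ i → glue (p i) ≡ f i
    glue-p i = cong [ f , _ ]′ (Fin.splitAt-↑ˡ K i (K + r))

    glue-q : ∀ i → glue (q i) ≡ g i
    glue-q i = trans (cong [ f , _ ]′ (Fin.splitAt-↑ʳ K (K + r) (i ↑ˡ r)))
                     (cong [ g , h ]′ (Fin.splitAt-↑ˡ K i r))

    glue-x : ∀ j → glue (x j) ≡ h j
    glue-x j = trans (cong [ f , _ ]′ (Fin.splitAt-↑ʳ K (K + r) (K ↑ʳ j)))
                     (cong [ g , h ]′ (Fin.splitAt-↑ʳ K r j))

  p-image : ∀ (e : Fin N → Fin N) → (∀ i → e (p i) ≡ p i) → (∀ i → e (q i) ≡ p i) → (∀ j → e (x j) ≡ p (ι j)) →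
            ∀ y → ∃ λ i → e y ≡ p i
  p-image e e-p e-q e-x y with block y
  ... | in-p i = i , e-p i
  ... | in-q i = i , e-q i
  ... | in-x j = ι j , e-x j

  -- p i, q i and x j are the points lying in the pairs of classes
  -- (i , i), (i , i − 1) and (j , j + 1) of the kernels of e and e′.
  module _ {e e′ : Fin N → Fin N}
           (e-p : ∀ i → e (p i) ≡ p i) (e-q : ∀ i → e (q i) ≡ p i) (e-x : ∀ j → e (x j) ≡ p (ι j))
           (e′-q : ∀ i → e′ (q i) ≡ q i) (e′-p : ∀ i → e′ (p i) ≡ q (R i))
           (e′-x : ∀ j → e′ (x j) ≡ q (R (R (ι j)))) where

    e-image : ∀ y → ∃ λ i → e y ≡ p i
    e-image = p-image e e-p e-q e-x

    -- The pair of classes `(s , s + 1)` belongs to no point of the two blocks, because neither `R`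
    -- nor its square has a fixed point.
    extra : ∀ s z → e z ≡ p s → e′ z ≡ q (R (R s)) → ∃ λ j → z ≡ x j × ι j ≡ s
    extra s z ez e′z with block z
    ... | in-x j = j , refl , p-injective (ι j) s (trans (sym (e-x j)) ez)
    ... | in-p i = contradiction (trans (sym Ri≡RRs) (cong R i≡s)) (R≢ (R s))
      where
      i≡s : i ≡ s
      i≡s = p-injective i s (trans (sym (e-p i)) ez)
      Ri≡RRs : R i ≡ R (R s)
      Ri≡RRs = q-injective (R i) (R (R s)) (trans (sym (e′-p i)) e′z)
    ... | in-q i = contradiction (trans (sym i≡RRs) i≡s) (RR≢ s)
      where
      i≡s : i ≡ s
      i≡s = p-injective i s (trans (sym (e-q i)) ez)
      i≡RRs : i ≡ R (R s)
      i≡RRs = q-injective i (R (R s)) (trans (sym (e′-q i)) e′z)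

    -- `σ` is a rotation preserving {0} or {0, 1}. In the second case, sending 0 to 1 would send 1
    -- to 2, which is not an extra index.
    rotation-preserving-extras : (σ : Fin K → Fin K) → (∀ i → σ (R i) ≡ R (σ i)) →
                                 (∀ j → ∃ λ j′ → ι j′ ≡ σ (ι j)) → σ zero ≡ zero
    rotation-preserving-extras = by-extras b refl
      where
      by-extras : ∀ c → c ≡ b → (σ : Fin K → Fin K) → (∀ i → σ (R i) ≡ R (σ i)) →
                  (∀ j → ∃ λ j′ → ι j′ ≡ σ (ι j)) → σ zero ≡ zero
      by-extras 0F refl σ σR closed with closed zero
      ... | zero , eq = sym eq
      by-extras 1F refl σ σR closed with closed zero | closed (suc zero)
      ... | zero     , eq | _ = sym eq
      ... | suc zero , eq | j , eq′ = ⊥-elim (not-extra j (trans eq′ (begin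
              σ (suc zero)  ≡⟨ cong σ (sym (R-inject₁ zero)) ⟩
              σ (R zero)    ≡⟨ σR zero ⟩
              R (σ zero)    ≡⟨ cong R (sym eq) ⟩
              R (suc zero)  ≡⟨ R-inject₁ (suc zero) ⟩
              suc (suc zero) ∎)))
        where
        open ≡-Reasoning
        not-extra : ∀ j → ι j ≢ suc (suc zero)
        not-extra zero ()
        not-extra (suc zero) ()

    -- On the block `p`, the composite of `e′` followed by `e` acts as `R`. So `y` is either
    -- undefined on all of `p`, hence empty, or acts there by some `σ` commuting with `R`. The extra
    -- points then force `σ` to be the identity, and `y` fixes everything.
    rigid : Rigid e e′
    rigid y ey e′y with Y (p zero) in start
      where Y = lookup y
    ... | nothing = nowhere⇒central nowhere
      where
      Y = lookup y
      on-p : ∀ i → Y (p i) ≡ nothing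
      on-p = R-induction (λ i → Y (p i) ≡ nothing) start λ i eq → begin
        Y (p (R i))                      ≡⟨ cong Y (sym (trans (cong e (e′-p i)) (e-q (R i)))) ⟩
        Y (e (e′ (p i)))                 ≡⟨ trans (ey (e′ (p i))) (cong (Maybe.map e) (e′y (p i))) ⟩
        Maybe.map e (Maybe.map e′ (Y (p i))) ≡⟨ cong (Maybe.map e ∘ Maybe.map e′) eq ⟩
        nothing                          ∎
        where open ≡-Reasoning
      nowhere : ∀ z → Y z ≡ nothing
      nowhere z with e-image z
      ... | i , ez = map-nothing⁻¹ (trans (sym (ey z)) (trans (cong Y ez) (on-p i)))
    ... | just w = identity⇒central everywhere
      where
      open ≡-Reasoning
      Y = lookup y
      on-p : ∀ i → ∃ λ s → Y (p i) ≡ just (p s)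
      next : ∀ i s → Y (p i) ≡ just (p s) → Y (p (R i)) ≡ just (p (R s))
      next i s eq = begin
        Y (p (R i))                      ≡⟨ cong Y (sym (trans (cong e (e′-p i)) (e-q (R i)))) ⟩
        Y (e (e′ (p i)))                 ≡⟨ trans (ey (e′ (p i))) (cong (Maybe.map e) (e′y (p i))) ⟩
        Maybe.map e (Maybe.map e′ (Y (p i))) ≡⟨ cong (Maybe.map e ∘ Maybe.map e′) eq ⟩
        just (e (e′ (p s)))              ≡⟨ cong just (trans (cong e (e′-p s)) (e-q (R s))) ⟩
        just (p (R s))                   ∎
      on-p = R-induction (λ i → ∃ λ s → Y (p i) ≡ just (p s))
        (proj₁ (e-image w) , (begin
          Y (p zero)               ≡⟨ cong Y (sym (e-p zero)) ⟩
          Y (e (p zero))           ≡⟨ trans (ey (p zero)) (cong (Maybe.map e) start) ⟩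
          just (e w)               ≡⟨ cong just (proj₂ (e-image w)) ⟩
          just (p (proj₁ (e-image w))) ∎))
        λ i (s , eq) → R s , next i s eq
      σ : Fin K → Fin K
      σ = proj₁ ∘ on-p
      σR : ∀ i → σ (R i) ≡ R (σ i)
      σR i = p-injective (σ (R i)) (R (σ i)) (just-injective (trans (sym (proj₂ (on-p (R i)))) (next i (σ i) (proj₂ (on-p i)))))
      -- The image of an extra point has classes `(s , s + 1)` for `s = σ (ι j)`, so `extra` shows
      -- that it is again an extra point.
      on-x : ∀ j → ∃ λ j′ → Y (x j) ≡ just (x j′) × ι j′ ≡ σ (ι j)
      on-x j with map-just⁻¹ (trans (sym (ey (x j))) (trans (cong Y (e-x j)) (proj₂ (on-p (ι j)))))
      ... | z , Yx , ez with extra (σ (ι j)) z ez (just-injective (begin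
            just (e′ z)                    ≡⟨ cong (Maybe.map e′) (sym Yx) ⟩
            Maybe.map e′ (Y (x j))         ≡⟨ sym (e′y (x j)) ⟩
            Y (e′ (x j))                   ≡⟨ cong Y (trans (e′-x j) (sym (e′-p (R (ι j))))) ⟩
            Y (e′ (p (R (ι j))))           ≡⟨ e′y (p (R (ι j))) ⟩
            Maybe.map e′ (Y (p (R (ι j)))) ≡⟨ cong (Maybe.map e′) (next (ι j) (σ (ι j)) (proj₂ (on-p (ι j)))) ⟩
            just (e′ (p (R (σ (ι j)))))    ≡⟨ cong just (e′-p (R (σ (ι j)))) ⟩
            just (q (R (R (σ (ι j)))))     ∎))
      ...   | j′ , refl , ιj′ = j′ , Yx , ιj′
      σ-id : ∀ i → σ i ≡ i
      σ-id = R-induction (λ i → σ i ≡ i)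
        (rotation-preserving-extras σ σR λ j → proj₁ (on-x j) , proj₂ (proj₂ (on-x j)))
        λ i eq → trans (σR i) (cong R eq)
      fixes-p : ∀ i → Y (p i) ≡ just (p i)
      fixes-p i = trans (proj₂ (on-p i)) (cong (just ∘ p) (σ-id i))
      everywhere : ∀ z → Y z ≡ just z
      everywhere z with block z
      ... | in-p i = fixes-p i
      -- The block `q` is the image of `p` under `e′`, so fixing `p` fixes `q`.
      ... | in-q i = begin
        Y (q i)                          ≡⟨ cong Y (sym (trans (e′-p (L i)) (cong q (RL i)))) ⟩
        Y (e′ (p (L i)))                 ≡⟨ e′y (p (L i)) ⟩
        Maybe.map e′ (Y (p (L i)))       ≡⟨ cong (Maybe.map e′) (fixes-p (L i)) ⟩
        just (e′ (p (L i)))              ≡⟨ cong just (trans (e′-p (L i)) (cong q (RL i))) ⟩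
        just (q i)                       ∎
      ... | in-x j with on-x j
      ...   | j′ , Yx , ιj′ = trans Yx (cong (just ∘ x) (ι-injective j′ j (trans ιj′ (σ-id (ι j)))))

  -- The tail runs down through the extra points and `q` into the `K`-cycle `p`. Thus `K` steps take
  -- `x` to `q` and `q` to `p`, keeping indices, and fix `p`.
  h : Fin N → Fin N
  h = descend (p (fromℕ (suc (suc m))))

  -- Two rounds of `K` steps, since the extra points need two to reach `p`.
  M : ℕ
  M = K + K

  down : ∀ z z′ → toℕ z ≡ K + toℕ z′ → (h ^ K) z ≡ z′
  down z z′ eq = Fin.toℕ-injective (trans (toℕ-descend^ _ K z (subst (K ≤_) (sym eq) (ℕ.m≤m+n K (toℕ z′))))
    (trans (cong (_∸ K) eq) (ℕ.m+n∸m≡n K (toℕ z′))))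

  h^K-p : ∀ i → (h ^ K) (p i) ≡ p i
  h^K-p i = trans (cong (λ k → (h ^ suc k) (p i)) (sym last≡))
    (descend^-period _ (p i) (subst₂ _≤_ (sym (Fin.toℕ-↑ˡ i (K + r))) (sym last≡) (Fin.toℕ≤pred[n] i)))
    where
    last≡ : toℕ (p (fromℕ (suc (suc m)))) ≡ suc (suc m)
    last≡ = trans (Fin.toℕ-↑ˡ (fromℕ (suc (suc m))) (K + r)) (Fin.toℕ-fromℕ (suc (suc m)))

  h^K-q : ∀ i → (h ^ K) (q i) ≡ p i
  h^K-q i = down (q i) (p i) (trans (Fin.toℕ-↑ʳ K (i ↑ˡ r))
    (cong (K +_) (trans (Fin.toℕ-↑ˡ i r) (sym (Fin.toℕ-↑ˡ i (K + r))))))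

  h^K-x : ∀ j → (h ^ K) (x j) ≡ q (ι j)
  h^K-x j = down (x j) (q (ι j)) (trans (Fin.toℕ-↑ʳ K (K ↑ʳ j)) (cong (K +_) (trans (Fin.toℕ-↑ʳ K j)
    (sym (trans (Fin.toℕ-↑ʳ K (ι j ↑ˡ r)) (cong (K +_) (trans (Fin.toℕ-↑ˡ (ι j) r) (Fin.toℕ-inject≤ j r≤K))))))))

  h^M-p : ∀ i → (h ^ M) (p i) ≡ p i
  h^M-p i = trans (^-+ h K K (p i)) (trans (cong (h ^ K) (h^K-p i)) (h^K-p i))

  h^M-q : ∀ i → (h ^ M) (q i) ≡ p i
  h^M-q i = trans (^-+ h K K (q i)) (trans (cong (h ^ K) (h^K-q i)) (h^K-p i))

  h^M-x : ∀ j → (h ^ M) (x j) ≡ p (ι j)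
  h^M-x j = trans (^-+ h K K (x j)) (trans (cong (h ^ K) (h^K-x j)) (h^K-q (ι j)))

  h^M-idempotent : ∀ y → (h ^ M) ((h ^ M) y) ≡ (h ^ M) y
  h^M-idempotent y with p-image (h ^ M) h^M-p h^M-q h^M-x y
  ... | i , eq = trans (cong (h ^ M) eq) (trans (h^M-p i) (sym eq))

  -- The shifts by two and by one are chosen so that conjugating the idempotent `h ^ M` by `π`
  -- yields the `e′` of `rigid`: identity on `q`, shift by one from `p`, shift by two from `x`.
  π ρ : Fin N → Fin N
  π = glue (λ i → q (R (R i))) (λ i → p (R i)) x
  ρ = glue (λ i → q (L i)) (λ i → p (L (L i))) x

  π-p : ∀ i → π (p i) ≡ q (R (R i))
  π-p = glue-p _ _ _
  π-q : ∀ i → π (q i) ≡ p (R i)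
  π-q = glue-q _ _ _
  π-x : ∀ j → π (x j) ≡ x j
  π-x = glue-x _ _ _
  ρ-p : ∀ i → ρ (p i) ≡ q (L i)
  ρ-p = glue-p _ _ _
  ρ-q : ∀ i → ρ (q i) ≡ p (L (L i))
  ρ-q = glue-q _ _ _
  ρ-x : ∀ j → ρ (x j) ≡ x j
  ρ-x = glue-x _ _ _

  πρ : ∀ y → π (ρ y) ≡ y
  πρ y with block y
  ... | in-p i = trans (cong π (ρ-p i)) (trans (π-q (L i)) (cong p (RL i)))
  ... | in-q i = trans (cong π (ρ-q i)) (trans (π-p (L (L i))) (cong q (trans (cong R (RL (L i))) (RL i))))
  ... | in-x j = trans (cong π (ρ-x j)) (π-x j)

  ρπ : ∀ y → ρ (π y) ≡ y
  ρπ y with block y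
  ... | in-p i = trans (cong ρ (π-p i)) (trans (ρ-q (R (R i))) (cong p (trans (cong L (LR (R i))) (LR i))))
  ... | in-q i = trans (cong ρ (π-q i)) (trans (ρ-p (R i)) (cong q (LR i)))
  ... | in-x j = trans (cong ρ (π-x j)) (ρ-x j)

  open Conjugate π ρ πρ ρπ h

  conj^M-q : ∀ i → (conj ^ M) (q i) ≡ q i
  conj^M-q i = begin
    (conj ^ M) (q i)                 ≡⟨ conj-^ M (q i) ⟩
    π ((h ^ M) (ρ (q i)))            ≡⟨ cong (π ∘ (h ^ M)) (ρ-q i) ⟩
    π ((h ^ M) (p (L (L i))))        ≡⟨ cong π (trans (h^M-p (L (L i))) (sym (ρ-q i))) ⟩
    π (ρ (q i))                      ≡⟨ πρ (q i) ⟩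
    q i                              ∎
    where open ≡-Reasoning

  conj^M-p : ∀ i → (conj ^ M) (p i) ≡ q (R i)
  conj^M-p i = begin
    (conj ^ M) (p i)                 ≡⟨ conj-^ M (p i) ⟩
    π ((h ^ M) (ρ (p i)))            ≡⟨ cong (π ∘ (h ^ M)) (ρ-p i) ⟩
    π ((h ^ M) (q (L i)))            ≡⟨ cong π (h^M-q (L i)) ⟩
    π (p (L i))                      ≡⟨ π-p (L i) ⟩
    q (R (R (L i)))                  ≡⟨ cong (q ∘ R) (RL i) ⟩
    q (R i)                          ∎
    where open ≡-Reasoning

  conj^M-x : ∀ j → (conj ^ M) (x j) ≡ q (R (R (ι j)))
  conj^M-x j = begin
    (conj ^ M) (x j)                 ≡⟨ conj-^ M (x j) ⟩
    π ((h ^ M) (ρ (x j)))            ≡⟨ cong (π ∘ (h ^ M)) (ρ-x j) ⟩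
    π ((h ^ M) (x j))                ≡⟨ cong π (h^M-x j) ⟩
    π (p (ι j))                      ≡⟨ π-p (ι j) ⟩
    q (R (R (ι j)))                  ∎
    where open ≡-Reasoning

  moves : ∀ (e : Fin N → Fin N) {i y} → (e ^ M) y ≡ i → i ≢ y → e y ≢ y
  moves e eq i≢y ey = i≢y (trans (sym eq) (^-fixed e M ey))

  distant-pair : ∃₂ λ (u v : Vertex N) → ¬ DistLe u v 4
  distant-pair = (total h , total-noncentral h {q zero} (moves h (h^M-q zero) p≢q)) ,
                 (total conj , total-noncentral conj {p zero} (moves conj (conj^M-p zero) q≢p)) ,
    distance≰4 M M (descend-generates _) (conj-generates (descend-generates _))
      h^M-idempotent (conj-idempotent M h^M-idempotent)
      (rigid h^M-p h^M-q h^M-x conj^M-q conj^M-p conj^M-x) refl refl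
    where
    p≢q : p zero ≢ q zero
    p≢q ()
    q≢p : q (R zero) ≢ p zero
    q≢p ()

halves : ∀ m → ∃₂ λ k (b : Fin 2) → m ≡ k + (k + toℕ b)
halves zero          = 0 , 0F , refl
halves (suc zero)    = 0 , 1F , refl
halves (suc (suc m)) with halves m
... | k , b , refl = suc k , b , cong suc (sym (ℕ.+-suc k (k + toℕ b)))

distant-pair-7 : 7 ≤ n → ∃₂ λ (u v : Vertex n) → ¬ DistLe u v 4
distant-pair-7 7≤n with ℕ.m≤n⇒∃[o]m+o≡n 7≤n
... | o , refl with halves o
...   | k , b , refl = subst (λ n → ∃₂ λ (u v : Vertex n) → ¬ DistLe u v 4) size (Blocks.distant-pair k b)
  where
  open +-*-Solver
  size : 3 + k + (3 + k + suc (toℕ b)) ≡ 7 + (k + (k + toℕ b))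
  size = solve 2 (λ k b → (con 3 :+ k) :+ ((con 3 :+ k) :+ (con 1 :+ b)) := con 7 :+ (k :+ (k :+ b))) refl k (toℕ b)

-- Exhaustive checks, and the case n = 6.

_≟ₚ_ : (f g : PT n) → Dec (f ≡ g)
_≟ₚ_ = Vec.≡-dec (Maybe-≟ _≟_)

_~?_ : (f g : PT n) → Dec (f ~ g)
f ~? g = (f · g) ≟ₚ (g · f)

all-Maybe? : ∀ {P : Maybe (Fin n) → Set} → Decidable P → Dec (∀ m → P m)
all-Maybe? P? = map′ (λ (Pn , Pj) → λ { nothing → Pn ; (just x) → Pj x }) (λ f → f nothing , f ∘ just)
  (P? nothing ×-dec Fin.all? (P? ∘ just))

all-Vec? : ∀ k {P : Vec (Maybe (Fin n)) k → Set} → Decidable P → Dec (∀ v → P v)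
all-Vec? zero    P? = map′ (λ { P[] [] → P[] }) (λ f → f []) (P? [])
all-Vec? (suc k) P? = map′ (λ { f (m ∷ v) → f m v }) (λ f m v → f (m ∷ v))
  (all-Maybe? λ m → all-Vec? k λ v → P? (m ∷ v))

equivariant? : ∀ (h : Fin n → Fin n) y → Dec (Equivariant h y)
equivariant? h y = Fin.all? λ x → Maybe-≟ _≟_ (lookup y (h x)) (Maybe.map h (lookup y x))

trivial⇒central : ∀ {f : PT n} → f ≡ emptyMap ⊎ f ≡ idMap → Central f
trivial⇒central (inj₁ refl) = emptyMap-central
trivial⇒central (inj₂ refl) = idMap-central

-- With `trivial⇒central`, this replaces noncentrality by two inequalities that can be tested in an
-- enumeration.
nontrivial⇒noncentral : ∀ {f : PT n} → f ≢ emptyMap → f ≢ idMap → ¬ Central f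
nontrivial⇒noncentral {f = f} f≢∅ f≢id
  with Fin.all? (λ x → Maybe-≟ _≟_ (lookup f x) nothing) | Fin.all? (λ x → Maybe-≟ _≟_ (lookup f x) (just x))
... | yes empty | _         = contradiction (ext λ x → trans (empty x) (sym (lookup-empty x))) f≢∅
... | no  _     | yes ident = contradiction (ext λ x → trans (ident x) (sym (lookup-id x))) f≢id
... | no  f≢∅′  | no f≢id′
  with Fin.¬∀⟶∃¬ _ _ (λ x → Maybe-≟ _≟_ (lookup f x) nothing) f≢∅′
     | Fin.¬∀⟶∃¬ _ _ (λ x → Maybe-≟ _≟_ (lookup f x) (just x)) f≢id′
...   | x , fx≢ | z , fz≢ with lookup f x in fx | lookup f z in fz
...     | nothing | _       = contradiction refl fx≢
...     | just _  | nothing = partial⇒noncentral {f = f} fx fz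
...     | just _  | just w  = moves⇒noncentral {f = f} fz (fz≢ ∘ cong just)

-- `chain₆` is a path into a 3-cycle, `c₆` the cycle 0, 2, 5, 1, 3, 4.
chain₆ c₆ : Fin 6 → Fin 6
chain₆ = descend 2F
c₆ = lookup (2F ∷ 3F ∷ 5F ∷ 4F ∷ 0F ∷ 1F ∷ [])

c₆-generates : Generates c₆ 0F
c₆-generates = toWitness {a? = Fin.all? λ x → Fin.any? λ i → (c₆ ^ toℕ i) 0F ≟ x} _

chain₆³-idempotent : ∀ x → (chain₆ ^ 3) ((chain₆ ^ 3) x) ≡ (chain₆ ^ 3) x
chain₆³-idempotent = toWitness {a? = Fin.all? λ x → (chain₆ ^ 3) ((chain₆ ^ 3) x) ≟ (chain₆ ^ 3) x} _

-- An equivariant `y` is determined by its values at 0 and 2, one point from each 3-cycle of the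
-- square; the 49 candidates are tested.
rigid-c₆² : Rigid (c₆ ^ 2) (chain₆ ^ 3)
rigid-c₆² y eqv eqv′ = trivial⇒central (subst (λ y → y ≡ emptyMap ⊎ y ≡ idMap) (sym y≡)
  (toWitness {a? = all-Maybe? λ a → all-Maybe? λ b →
      equivariant? (chain₆ ^ 3) (extend a b) →-dec ((extend a b ≟ₚ emptyMap) ⊎-dec (extend a b ≟ₚ idMap))} _
    (lookup y 0F) (lookup y 2F) (subst (Equivariant (chain₆ ^ 3)) y≡ eqv′)))
  where
  s : Maybe (Fin 6) → Maybe (Fin 6)
  s = Maybe.map (c₆ ^ 2)
  extend : Maybe (Fin 6) → Maybe (Fin 6) → PT 6
  extend a b = a ∷ s b ∷ b ∷ s (s a) ∷ s (s b) ∷ s a ∷ []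
  y≡ : y ≡ extend (lookup y 0F) (lookup y 2F)
  y≡ = ext λ where
    0F → refl
    1F → eqv 2F
    2F → refl
    3F → trans (eqv 5F) (cong s (eqv 0F))
    4F → trans (eqv 1F) (cong s (eqv 2F))
    5F → eqv 0F

-- The cube consists of three transpositions, represented by 0, 2 and 5, which leaves 343
-- candidates.
rigid-c₆³ : Rigid (c₆ ^ 3) (chain₆ ^ 3)
rigid-c₆³ y eqv eqv′ = trivial⇒central (subst (λ y → y ≡ emptyMap ⊎ y ≡ idMap) (sym y≡)
  (toWitness {a? = all-Maybe? λ a → all-Maybe? λ b → all-Maybe? λ c →
      equivariant? (chain₆ ^ 3) (extend a b c) →-dec ((extend a b c ≟ₚ emptyMap) ⊎-dec (extend a b c ≟ₚ idMap))} _
    (lookup y 0F) (lookup y 2F) (lookup y 5F) (subst (Equivariant (chain₆ ^ 3)) y≡ eqv′)))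
  where
  s : Maybe (Fin 6) → Maybe (Fin 6)
  s = Maybe.map (c₆ ^ 3)
  extend : Maybe (Fin 6) → Maybe (Fin 6) → Maybe (Fin 6) → PT 6
  extend a b c = a ∷ s a ∷ b ∷ s b ∷ s c ∷ c ∷ []
  y≡ : y ≡ extend (lookup y 0F) (lookup y 2F) (lookup y 5F)
  y≡ = ext λ where
    0F → refl
    1F → eqv 0F
    2F → refl
    3F → eqv 2F
    4F → eqv 5F
    5F → refl

distant-pair-6 : ∃₂ λ (u v : Vertex 6) → ¬ DistLe u v 4
distant-pair-6 = u , v , far
  where
  u v : Vertex 6
  u = total c₆ , total-noncentral c₆ {0F} λ ()
  v = total chain₆ , total-noncentral chain₆ {0F} λ ()
  power-rigid : ∀ i {y} → ¬ Central (total (c₆ ^ toℕ i)) → Equivariant (c₆ ^ toℕ i) y →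
                Equivariant (chain₆ ^ 3) y → Central y
  power-rigid i {y} z≁ eqv eqv′ = by-exponent i z≁ eqv
    where
    -- Every exponent 1, 2, 4, 5 has a multiple congruent to 2 modulo 6; only 3 needs the cube.
    through-square : ∀ k j → (∀ x → ((c₆ ^ k) ^ j) x ≡ (c₆ ^ 2) x) → Equivariant (c₆ ^ k) y → Central y
    through-square k j same eqv = rigid-c₆² y (equivariant-cong {f = y} same (equivariant-^ {f = y} eqv j)) eqv′
    by-exponent : ∀ i → ¬ Central (total (c₆ ^ toℕ i)) → Equivariant (c₆ ^ toℕ i) y → Central y
    by-exponent 0F z≁ _   = contradiction (total-identity λ _ → refl) z≁
    by-exponent 1F _  eqv = through-square 1 2 (λ _ → refl) eqv
    by-exponent 2F _  eqv = through-square 2 1 (λ _ → refl) eqv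
    by-exponent 3F _  eqv = rigid-c₆³ y eqv eqv′
    by-exponent 4F _  eqv = through-square 4 2 (toWitness {a? = Fin.all? λ x → ((c₆ ^ 4) ^ 2) x ≟ (c₆ ^ 2) x} _) eqv
    by-exponent 5F _  eqv = through-square 5 4 (toWitness {a? = Fin.all? λ x → ((c₆ ^ 5) ^ 4) x ≟ (c₆ ^ 2) x} _) eqv
  far : ¬ DistLe u v 4
  far uv with DistLe-uncons uv
  ... | (z , z≁) , uz , zv with DistLe-uncons zv
  ...   | (y , y≁) , zy , yv with DistLe-uncons yv
  -- The permutation `c₆` has only the identity as idempotent power, so on this side `z` itself is
  -- identified as a power of `c₆`.
  ...     | (z′ , z′≁) , yz′ , z′v with centralizer-of-generated {f = z} c₆-generates z≁ (sym uz)
  ...       | i , refl = y≁ (power-rigid i z≁ (~⇒equivariant (sym zy))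
                (commutes-with-idempotent-power 3 (descend-generates 2F) chain₆³-idempotent {z′} {y} z′≁
                  (sym (DistLe-1 z′v)) (sym yz′)))

-- The case n = 4.

vectors : ∀ {A : Set} → List A → ∀ k → List (Vec A k)
vectors xs zero    = [] ∷ []
vectors xs (suc k) = cartesianProductWith _∷_ xs (vectors xs k)

-- The hubs number 16 + 40 + 3. A map undefined somewhere commutes with an elementary map; a total
-- map that is no permutation with its idempotent power; a permutation with a fixed point with the
-- constant there; any other permutation with a fixed-point-free involution.
partial-maps elementary-maps idempotents involutions hubs : List (PT 4)
partial-maps    = vectors (nothing ∷ List.map just (allFin 4)) 4
elementary-maps = cartesianProductWith elementary (allFin 4) (allFin 4)
idempotents     = filter (λ f → ((f · f) ≟ₚ f) ×-dec ¬? (f ≟ₚ idMap)) (vectors (List.map just (allFin 4)) 4)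
involutions     = (just 1F ∷ just 0F ∷ just 3F ∷ just 2F ∷ [])
                ∷ (just 2F ∷ just 3F ∷ just 0F ∷ just 1F ∷ [])
                ∷ (just 3F ∷ just 2F ∷ just 1F ∷ just 0F ∷ []) ∷ []
hubs = elementary-maps ++ idempotents ++ involutions

Nontrivial : PT 4 → Set
Nontrivial f = f ≢ emptyMap × f ≢ idMap

nontrivial? : ∀ f → Dec (Nontrivial f)
nontrivial? f = ¬? (f ≟ₚ emptyMap) ×-dec ¬? (f ≟ₚ idMap)

hubs-nontrivial : All Nontrivial hubs
hubs-nontrivial = toWitness {a? = All.all? nontrivial? hubs} _

-- The lists searched below are arguments of the decision procedures, so that they are evaluated once.
near? : (gs : List (PT 4)) → Dec (∀ f → Nontrivial f → Any (f ~_) gs)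
near? gs = all-Vec? 4 λ f → nontrivial? f →-dec Any.any? (f ~?_) gs

near-hub : ∀ f → Nontrivial f → Any (f ~_) hubs
near-hub = toWitness {a? = near? hubs} _

Between : (f g y : PT 4) → Set
Between f g y = f ~ y × y ~ g × Nontrivial y

Linked : (ys gs fs : List (PT 4)) → Set
Linked ys gs fs = All (λ f → All (λ g → Any (Between f g) ys) gs) fs

linked? : ∀ ys gs fs → Dec (Linked ys gs fs)
linked? ys gs = All.all? λ f → All.all? (λ g →
  Any.any? (λ y → (f ~? y) ×-dec ((y ~? g) ×-dec nontrivial? y)) ys) gs

-- The path runs from `u` to a hub, to a common neighbour of two hubs, to the second hub, to `v`.
via-hubs : ∀ gs ys → All Nontrivial gs → (∀ f → Nontrivial f → Any (f ~_) gs) → Linked ys gs gs →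
           ∀ (u v : Vertex 4) → DistLe u v 4
via-hubs gs ys gs-nontrivial near gs-linked u v = join (hub-of u) (hub-of v)
  where
  hub-of : ∀ (u : Vertex 4) → ∃ λ g → g ∈ gs × proj₁ u ~ g
  hub-of (f , f≁) = find (near f (f≁ ∘ trivial⇒central ∘ inj₁ , f≁ ∘ trivial⇒central ∘ inj₂))
  vertex : ∀ f → Nontrivial f → Vertex 4
  vertex f (f≢∅ , f≢id) = f , nontrivial⇒noncentral f≢∅ f≢id
  join : (∃ λ g → g ∈ gs × proj₁ u ~ g) → (∃ λ g → g ∈ gs × proj₁ v ~ g) → DistLe u v 4
  join (g , g∈ , ug) (g′ , g′∈ , vg′) with Any.satisfied (All.lookup (All.lookup gs-linked g∈) g′∈)
  ... | y , gy , yg′ , y-nontrivial =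
    ~⇒DistLe {v = vertex g (All.lookup gs-nontrivial g∈)} ug
    (~⇒DistLe {v = vertex y y-nontrivial} gy
    (~⇒DistLe {v = vertex g′ (All.lookup gs-nontrivial g′∈)} yg′
    (~⇒DistLe (sym vg′) DistLe-refl)))

HubsLinkedTo : List (PT 4) → Set
HubsLinkedTo = Linked (hubs ++ partial-maps) hubs

elementary-linked : HubsLinkedTo elementary-maps
elementary-linked = toWitness {a? = linked? (hubs ++ partial-maps) hubs elementary-maps} _

idempotents-linked : HubsLinkedTo idempotents
idempotents-linked = toWitness {a? = linked? (hubs ++ partial-maps) hubs idempotents} _

involutions-linked : HubsLinkedTo involutions
involutions-linked = toWitness {a? = linked? (hubs ++ partial-maps) hubs involutions} _

hubs-linked : HubsLinkedTo hubs
hubs-linked = All.++⁺ elementary-linked (All.++⁺ idempotents-linked involutions-linked)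

distance-4≤4 : ∀ (u v : Vertex 4) → DistLe u v 4
distance-4≤4 = via-hubs hubs (hubs ++ partial-maps) hubs-nontrivial near-hub hubs-linked

-- On a path of length 3, the neighbour `z` of the 4-cycle is a nontrivial power of it and so moves
-- 0. But `z` also commutes with the idempotent power of `chain₄`, the constant 0, and so would fix
-- 0.
distant-pair-4 : ∃₂ λ (u v : Vertex 4) → ¬ DistLe u v 3
distant-pair-4 = u , v , far
  where
  chain₄ : Fin 4 → Fin 4
  chain₄ = descend 0F
  u v : Vertex 4
  u = total cycle , total-noncentral cycle {0F} λ ()
  v = total chain₄ , total-noncentral chain₄ {1F} λ ()
  moves-0 : ∀ (i : Fin 4) → ¬ Central (total (cycle ^ toℕ i)) → 0F ≢ (cycle ^ toℕ i) 0F
  moves-0 0F z≁ _ = z≁ (total-identity λ _ → refl)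
  moves-0 1F _ ()
  moves-0 2F _ ()
  moves-0 3F _ ()
  chain₄³-constant : ∀ x → (chain₄ ^ 3) x ≡ 0F
  chain₄³-constant = toWitness {a? = Fin.all? λ x → (chain₄ ^ 3) x ≟ 0F} _
  chain₄³-idempotent : ∀ x → (chain₄ ^ 3) ((chain₄ ^ 3) x) ≡ (chain₄ ^ 3) x
  chain₄³-idempotent x = trans (chain₄³-constant ((chain₄ ^ 3) x)) (sym (chain₄³-constant x))
  far : ¬ DistLe u v 3
  far uv with DistLe-uncons uv
  ... | (z , z≁) , uz , zv with DistLe-uncons zv
  ...   | (z′ , z′≁) , zz′ , z′v with centralizer-of-generated {f = z} (descend-generates 3F) z≁ (sym uz)
  ...     | i , refl = moves-0 i z≁ (sym (trans
              (total-~-elim (cycle ^ toℕ i) (chain₄ ^ 3) (equivariant⇒~ {f = total (cycle ^ toℕ i)}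
                (commutes-with-idempotent-power 3 (descend-generates 0F) chain₄³-idempotent
                  {z′} {total (cycle ^ toℕ i)} z′≁ (sym (DistLe-1 z′v)) (sym zz′))) 0F)
              (chain₄³-constant ((cycle ^ toℕ i) 0F))))

-- Exact diameters from matching bounds.

diameter : ∀ {n d} → (∀ (u v : Vertex n) → DistLe u v (suc d)) →
           (∃₂ λ (u v : Vertex n) → ¬ DistLe u v d) → Diam n (suc d)
diameter {d = d} near (u , v , far) = near , u , v , exact (near u v) , λ m m≤d walk → far (m , s≤s⁻¹ m≤d , walk)
  where
  exact : DistLe u v (suc d) → Walk u v (suc d)
  exact (m , m≤1+d , walk) with ℕ.m≤n⇒m<n∨m≡n m≤1+d
  ... | inj₁ m≤d  = contradiction (m , s≤s⁻¹ m≤d , walk) far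
  ... | inj₂ refl = walk

theorem3p15 : (n : ℕ) → 2 ≤ n →
    (Prime n → ¬ Connected n) × (n ≡ 4 → Diam n 4) × (6 ≤ n → Composite n → Diam n 5)
theorem3p15 n 2≤n =
    prime⇒disconnected 2≤n
  , (λ { refl → diameter distance-4≤4 distant-pair-4 })
  , λ 6≤n comp → diameter (distance≤5 (ℕ.≤-trans (ℕ.m≤m+n 3 3) 6≤n) comp) (distant-pair 6≤n)
  where
  distant-pair : 6 ≤ n → ∃₂ λ (u v : Vertex n) → ¬ DistLe u v 4
  distant-pair 6≤n with ℕ.m≤n⇒m<n∨m≡n 6≤n
  ... | inj₁ 7≤n  = distant-pair-7 7≤n
  ... | inj₂ refl = distant-pair-6
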